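{- Let \(G\) be a graph on \(n\) vertices, \((T,\mathcal{X})\) a tree decomposition of \(G\) of width at most \(t-1\), \(P\subseteq T\) a nonredundant path, and \(m\in\{1,\dots,n\}\). Then there is a partition \((B,W,Z)\) of \(V(G)\) into three (possibly empty) sets such that one of the following holds: 1) \(|B|=m\), \(Z=\emptyset\), and \(e_G(B,W)\leq 2t\,\Delta(G)\); or 2) \(|B|\leq m\leq |B|+|Z|\), \(0<|Z|\leq n/2\), \(e_G(B,W,Z)\leq t\,\Delta(G)\log_2\big(16/w^*(P,\mathcal{X})\big)\), and there is a tree decomposition \((T',\mathcal{X}')\) of the induced subgraph \(G[Z]\) of width at most \(t-1\) and a nonredundant path \(P'\subseteq T'\) with \(w^*(P',\mathcal{X}')\geq 2\,w^*(P,\mathcal{X})\).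
   Context: \(\Delta(G)\) is the maximum degree. For a partition \((V_1,\dots,V_k)\) of \(V(G)\), \(e_G(V_1,\dots,V_k)\) is the number of edges whose ends lie in different parts. A tree decomposition of a graph \(H\) is a pair \((T,\mathcal{X})\) where \(T\) is a tree and \(\mathcal{X}=(X^i)_{i\in V(T)}\) with \(X^i\subseteq V(H)\), such that every vertex of \(H\) lies in some \(X^i\), every edge of \(H\) is contained in some \(X^i\), and for all nodes \(i,j\) and every node \(h\) on the \(i\)–\(j\) path in \(T\), \(X^i\cap X^j\subseteq X^h\); its width is \(\max_i|X^i|-1\). For a path \(P\subseteq T\), \(w^*(P,\mathcal{X}) := |\bigcup_{i\in V(P)}X^i| / |V(H)|\). A path \(P=(i_0,i_1,\dots,i_\ell)\subseteq T\) (possibly a single node) has \(i_0\) as a nonredundant end if \(X^{i_0}\neq\emptyset\) and, when \(\ell\neq 0\), \(X^{i_h}\not\subseteq X^{i_{h-1}}\) for all \(h\in\{1,\dots,\ell\}\); \(P\) is nonredundant if one of its ends is a nonredundant end. -}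

module Defs where

open import Data.Nat using (ℕ; zero; suc; _+_; _*_; _^_; _≤_; _<_; _⊔_)
open import Data.Bool using (Bool; true; false; if_then_else_; _∧_; not)
open import Data.Fin using (Fin; zero; suc; toℕ; inject₁; fromℕ; _≟_)
open import Data.Fin.Subset using (Subset; _∈_; _⊆_; _∩_; ⋃; ∣_∣; ⊥)
open import Data.List using (List; map; foldr; allFin)
open import Data.Nat.ListAction using (sum)
open import Data.Vec using (tabulate)
open import Data.Product using (Σ; ∃; _×_)
open import Data.Sum using (_⊎_)
open import Relation.Nullary using (¬_; ⌊_⌋)
open import Relation.Binary.PropositionalEquality using (_≡_; _≢_)
open import Function.Definitions using (Injective)
open import Data.Nat using (_<ᵇ_)

record Graph (n : ℕ) : Set where
  field
    adj    : Fin n → Fin n → Bool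
    sym    : ∀ u v → adj u v ≡ adj v u
    irrefl : ∀ u → adj u u ≡ false
open Graph public

b2n : Bool → ℕ
b2n true  = 1
b2n false = 0

degree : ∀ {n} → Graph n → Fin n → ℕ
degree {n} G v = sum (map (λ u → b2n (adj G v u)) (allFin n))

maxDegree : ∀ {n} → Graph n → ℕ
maxDegree {n} G = foldr _⊔_ 0 (map (degree G) (allFin n))

-- A partition of V(G) into k labelled (possibly empty) parts: a labelling.
-- part j of the labelling f, as a subset of V(G)
part : ∀ {n k} → (Fin n → Fin k) → Fin k → Subset n
part f j = tabulate (λ v → ⌊ f v ≟ j ⌋)

crossEdges : ∀ {n k} → Graph n → (Fin n → Fin k) → ℕ
crossEdges {n} G f =
  sum (map (λ u → sum (map (λ v →
    b2n ((toℕ u <ᵇ toℕ v) ∧ adj G u v ∧ not ⌊ f u ≟ f v ⌋)) (allFin n))) (allFin n))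

record TPath {k : ℕ} (T : Fin k → Fin k → Set) : Set where
  field
    len  : ℕ
    node : Fin (suc len) → Fin k
    step : ∀ (h : Fin len) → T (node (inject₁ h)) (node (suc h))
    inj  : Injective _≡_ _≡_ node
open TPath public

first : ∀ {k} {T : Fin k → Fin k → Set} → TPath T → Fin k
first P = node P zero

last : ∀ {k} {T : Fin k → Fin k → Set} → TPath T → Fin k
last P = node P (fromℕ (len P))

record IsTree {k : ℕ} (T : Fin k → Fin k → Set) : Set where
  field
    nonempty  : 0 < k
    symmetric : ∀ i j → T i j → T j i
    irreflex  : ∀ i → ¬ T i i
    connected : ∀ i j → Σ (TPath T) (λ P → first P ≡ i × last P ≡ j)
    acyclic   : ∀ (P : TPath T) → 2 ≤ len P → ¬ T (last P) (first P)

-- A tree decomposition of the induced subgraph G[S] (S ⊆ V(G)).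
-- Taking S = ⊤ gives a tree decomposition of G itself.
record TreeDec {n : ℕ} (G : Graph n) (S : Subset n) : Set₁ where
  field
    k      : ℕ
    T      : Fin k → Fin k → Set
    isTree : IsTree T
    bag    : Fin k → Subset n
    bag⊆S  : ∀ i → bag i ⊆ S
    cover  : ∀ v → v ∈ S → ∃ λ i → v ∈ bag i
    edges  : ∀ u v → u ∈ S → v ∈ S → adj G u v ≡ true →
             ∃ λ i → u ∈ bag i × v ∈ bag i
    coh    : ∀ (P : TPath T) (h : Fin (suc (len P))) →
             bag (first P) ∩ bag (last P) ⊆ bag (node P h)
open TreeDec public

-- width ≤ t - 1, i.e. every bag has at most t vertices
WidthAtMost-1+ : ∀ {n} {G : Graph n} {S} → TreeDec G S → ℕ → Set
WidthAtMost-1+ D t = ∀ i → ∣ bag D i ∣ ≤ t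

-- |⋃_{i ∈ V(P)} X^i|  (numerator of w*(P, X); the denominator is |S|)
coverSize : ∀ {n} {G : Graph n} {S} (D : TreeDec G S) → TPath (T D) → ℕ
coverSize {n} D P = ∣ ⋃ (map (λ h → bag D (node P h)) (allFin (suc (len P)))) ∣

NonredStart : ∀ {n} {G : Graph n} {S} (D : TreeDec G S) → TPath (T D) → Set
NonredStart D P = ¬ (bag D (first P) ≡ ⊥) ×
  (∀ (h : Fin (len P)) → ¬ (bag D (node P (suc h)) ⊆ bag D (node P (inject₁ h))))

-- i_ℓ is a nonredundant end of P (the condition for the reversed path)
NonredEnd : ∀ {n} {G : Graph n} {S} (D : TreeDec G S) → TPath (T D) → Set
NonredEnd D P = ¬ (bag D (last P) ≡ ⊥) ×
  (∀ (h : Fin (len P)) → ¬ (bag D (node P (inject₁ h)) ⊆ bag D (node P (suc h))))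

Nonredundant : ∀ {n} {G : Graph n} {S} (D : TreeDec G S) → TPath (T D) → Set
Nonredundant D P = NonredStart D P ⊎ NonredEnd D P

{-# OPTIONS --safe #-}
module Submission where

-- Root T at the first node of P and call the nodes of P the spine. Every vertex
-- has a top, the bag nearest to the root that contains it; the r vertices with
-- top on the spine are those covered by P, so r = w*(P) n. List the vertices
-- branch by branch along the spine, spine vertices of each branch first, and bend
-- the list into a circle: every edge across a cut next to a spine vertex is
-- incident with one bag. If x and x + m are spine vertices for some position x,
-- the arc [x, x + m) is B. Otherwise, among the 2r spine vertices and their shifts
-- by m, some stretch of length L that starts at one kind and ends before the next
-- point of the other kind contains at least 2rL/n points. The corresponding arc of
-- spine vertices is Z. Its size is the slack available for B, so j halving steps
-- with 2^j r ≤ n, each removing a single bag, adjust the size of B.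

open import Defs
open import Data.Nat using (ℕ; zero; suc; pred; _+_; _*_; _∸_; _^_; _≤_; _<_; _⊔_; _≤ᵇ_; _<ᵇ_; _≤?_; _<?_; z≤n; s≤s; NonZero; >-nonZero)
open import Data.Nat.Properties hiding (suc-injective)
open import Data.Nat.DivMod using (_%_; _mod_; m%n<n; [m+n]%n≡m%n; m<n⇒m%n≡m; %-distribˡ-+; m%n%n≡m%n)
open import Relation.Binary.Definitions using (tri<; tri≈; tri>)
open import Data.Nat.Induction using (<-rec)
open import Data.Nat.Tactic.RingSolver using (solve-∀)
import Data.Nat.ListAction as ListAction
import Data.Bool
open import Data.Bool using (Bool; true; false; _∧_; _∨_; not; if_then_else_)
open import Data.Bool.Properties using (T-≡; ¬-not; ∧-zeroʳ; ∧-identityʳ)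
open import Data.Fin using (Fin; zero; suc; toℕ; fromℕ; fromℕ<; inject₁; opposite; punchOut)
import Data.Fin as Fin
open import Data.Fin.Properties using (suc-injective; toℕ-injective; toℕ<n; toℕ-fromℕ<; toℕ-inject₁; opposite-involutive; any?; injective⇒≤; punchOut-injective)
open import Data.Fin.Permutation using (Permutation′; permutation; _⟨$⟩ʳ_; _⟨$⟩ˡ_; inverseˡ; inverseʳ)
open import Data.Fin.Subset using (Subset; ⊤; ⊥; ⋃; ∣_∣; _∈_; _⊆_)
open import Data.Fin.Subset.Properties using (∈⊤; _∈?_; nonempty?; Empty-unique; x∈p∩q⁺; x∈p∩q⁻; x∈p∪q⁺; x∈p∪q⁻; ∉⊥)
open import Data.List using (map; foldr; allFin)
import Data.List as List
open import Data.List.Properties using (map-tabulate)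
open import Data.Vec using (lookup; tabulate)
open import Data.Vec.Properties using (lookup∘tabulate; tabulate∘lookup; lookup⇒[]=; []=⇒lookup)
open import Data.Product using (Σ; ∃; _×_; _,_; proj₁; proj₂)
open import Data.Sum using (_⊎_; inj₁; inj₂)
open import Function using (_∘_; id; case_of_)
open import Relation.Nullary using (¬_; Dec; yes; no; ⌊_⌋; contradiction)
open import Relation.Nullary.Decidable using (map′; _×-dec_; ¬?; dec-true; dec-false; isYes≗does)
open import Relation.Binary.PropositionalEquality renaming (sym to ≡-sym)
open import Algebra.Properties.CommutativeMonoid.Sum +-0-commutativeMonoid using (sum-cong-≗; sum-permute; ∑-comm; ∑-distrib-+; sum-replicate-zero) renaming (sum to ∑)
open import Function.Bundles using (Equivalence)

-- Counting vertices and crossing edges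

-- A cut of the circle at an arbitrary place may be crossed by edges from many bags of a branch. So
-- every arc has to begin and end next to spine vertices, and in general the size `m` can only be
-- approximated. The factor 2 in the density comes from counting two families on one circle: the
-- stretches of the two kinds alternate and together contain `r` spine vertices and `r` shifts on
-- `n` positions, so one of them reaches the mean `2 * r / n`. This is why `Z` doubles the ratio,
-- and also why few halvings suffice: `Z` contains all `c ≥ 2 * r * L / n` spine vertices of its
-- stretch, so the error has to shrink from `L` to `|Z| ≥ c`, by a factor of at most `n / (2 * r)`.
-- Rounding the number `j` of halvings up uses the 2, whence `2 ^ j ≤ n / r`. Three more bags pay
-- for the cuts at the two ends of `Z` and at the far end of the arc; `2 ^ (3 + j) ≤ 8 * n / r` lies
-- within the constant 16. If the dense stretch starts at a spine vertex and not at a shift, the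
-- construction is made for `n ∸ m`, and `B` and `W` change places.

VSet : ℕ → Set
VSet n = Fin n → Bool

count : ∀ {n} → VSet n → ℕ
count p = ∑ (b2n ∘ p)

true≢false : ∀ {b} → b ≡ true → ¬ b ≡ false
true≢false refl ()

∧-true : ∀ {a b} → (a ∧ b) ≡ true → a ≡ true × b ≡ true
∧-true {true} {true} refl = refl , refl

∧-true⁺ : ∀ {a b} → a ≡ true → b ≡ true → (a ∧ b) ≡ true
∧-true⁺ refl refl = refl

∨-false : ∀ {a b} → (a ∨ b) ≡ false → a ≡ false × b ≡ false
∨-false {false} {false} refl = refl , refl

⌊⌋-true : ∀ {P : Set} (P? : Dec P) → P → ⌊ P? ⌋ ≡ true
⌊⌋-true P? p = trans (isYes≗does P?) (dec-true P? p)

⌊⌋-false : ∀ {P : Set} (P? : Dec P) → ¬ P → ⌊ P? ⌋ ≡ false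
⌊⌋-false P? ¬p = trans (isYes≗does P?) (dec-false P? ¬p)

⌊⌋-true⁻ : ∀ {P : Set} (P? : Dec P) → ⌊ P? ⌋ ≡ true → P
⌊⌋-true⁻ (yes p) _ = p

<ᵇ-true⇒< : ∀ {m n} → (m <ᵇ n) ≡ true → m < n
<ᵇ-true⇒< {m} {n} eq = <ᵇ⇒< m n (Equivalence.from T-≡ eq)

<⇒<ᵇ-true : ∀ {m n} → m < n → (m <ᵇ n) ≡ true
<⇒<ᵇ-true m<n = Equivalence.to T-≡ (<⇒<ᵇ m<n)

<ᵇ-false⇒≥ : ∀ {m n} → (m <ᵇ n) ≡ false → n ≤ m
<ᵇ-false⇒≥ eq = ≮⇒≥ λ m<n → true≢false (<⇒<ᵇ-true m<n) eq

≥⇒<ᵇ-false : ∀ {m n} → n ≤ m → (m <ᵇ n) ≡ false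
≥⇒<ᵇ-false n≤m = ¬-not λ eq → ≤⇒≯ n≤m (<ᵇ-true⇒< eq)

∑-mono-≤ : ∀ {n} {f g : Fin n → ℕ} → (∀ i → f i ≤ g i) → ∑ f ≤ ∑ g
∑-mono-≤ {zero}  f≤g = z≤n
∑-mono-≤ {suc n} f≤g = +-mono-≤ (f≤g zero) (∑-mono-≤ (f≤g ∘ suc))

∑-*-distribʳ : ∀ {n} (f : Fin n → ℕ) c → ∑ (λ i → f i * c) ≡ ∑ f * c
∑-*-distribʳ {zero}  f c = refl
∑-*-distribʳ {suc n} f c =
  trans (cong (f zero * c +_) (∑-*-distribʳ (f ∘ suc) c)) (≡-sym (*-distribʳ-+ c (f zero) _))

∑-upper : ∀ {n} (f : Fin n → ℕ) i → f i ≤ ∑ f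
∑-upper {suc n} f zero    = m≤m+n _ _
∑-upper {suc n} f (suc i) = ≤-trans (∑-upper (f ∘ suc) i) (m≤n+m _ _)

b2n-mono : ∀ {a b} → (a ≡ true → b ≡ true) → b2n a ≤ b2n b
b2n-mono {false}         _   = z≤n
b2n-mono {true}  {true}  _   = s≤s z≤n
b2n-mono {true}  {false} a⇒b with () ← a⇒b refl

b2n≤1 : ∀ b → b2n b ≤ 1
b2n≤1 true  = s≤s z≤n
b2n≤1 false = z≤n

module _ {n : ℕ} where

  count-mono : {p q : VSet n} → (∀ v → p v ≡ true → q v ≡ true) → count p ≤ count q
  count-mono p⊆q = ∑-mono-≤ (λ v → b2n-mono (p⊆q v))

  count-cong : {p q : VSet n} → (∀ v → p v ≡ q v) → count p ≡ count q
  count-cong p≗q = sum-cong-≗ (λ v → cong b2n (p≗q v))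

  count-+ : {p q r : VSet n} → (∀ v → b2n (p v) ≡ b2n (q v) + b2n (r v)) →
            count p ≡ count q + count r
  count-+ {p} {q} {r} eq = trans (sum-cong-≗ eq) (∑-distrib-+ (b2n ∘ q) (b2n ∘ r))

  count-∨-≤ : (p q : VSet n) → count (λ v → p v ∨ q v) ≤ count p + count q
  count-∨-≤ p q =
    ≤-trans (∑-mono-≤ (λ v → b2n-∨ (p v) (q v))) (≤-reflexive (∑-distrib-+ (b2n ∘ p) (b2n ∘ q)))
    where
    b2n-∨ : ∀ a b → b2n (a ∨ b) ≤ b2n a + b2n b
    b2n-∨ true  b = s≤s z≤n
    b2n-∨ false b = ≤-refl

  count-∨ : (p q : VSet n) → (∀ v → p v ≡ true → q v ≡ false) →
            count (λ v → p v ∨ q v) ≡ count p + count q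
  count-∨ p q disj = count-+ (λ v → eq (p v) (q v) (disj v))
    where
    eq : ∀ a b → (a ≡ true → b ≡ false) → b2n (a ∨ b) ≡ b2n a + b2n b
    eq true  b d rewrite d refl = refl
    eq false b d = refl

  count-∖ : (p q : VSet n) → (∀ v → q v ≡ true → p v ≡ true) →
            count p ≡ count q + count (λ v → p v ∧ not (q v))
  count-∖ p q q⊆p = count-+ (λ v → eq (p v) (q v) (q⊆p v))
    where
    eq : ∀ a b → (b ≡ true → a ≡ true) → b2n a ≡ b2n b + b2n (a ∧ not b)
    eq a     true  s rewrite s refl = refl
    eq true  false s = refl
    eq false false s = refl

  count-∈ : {p : VSet n} (v : Fin n) → p v ≡ true → 1 ≤ count p
  count-∈ {p} v v∈p = ≤-trans (≤-reflexive (cong b2n (≡-sym v∈p))) (∑-upper (b2n ∘ p) v)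

  count-strict : {p q : VSet n} (w : Fin n) → (∀ v → p v ≡ true → q v ≡ true) →
                 p w ≡ false → q w ≡ true → count p < count q
  count-strict {p} {q} w p⊆q w∉p w∈q = begin-strict
    count p                                      <⟨ m<m+n (count p) (count-∈ w w∈q∖p) ⟩
    count p + count (λ v → q v ∧ not (p v))      ≡⟨ count-∖ q p p⊆q ⟨
    count q                                      ∎
    where
    open ≤-Reasoning
    w∈q∖p : (q w ∧ not (p w)) ≡ true
    w∈q∖p rewrite w∉p | w∈q = refl

  count-none : (p : VSet n) → (∀ v → p v ≡ false) → count p ≡ 0
  count-none p none = trans (sum-cong-≗ (λ v → cong b2n (none v))) (sum-replicate-zero n)

count-full : ∀ {n} (p : VSet n) → (∀ v → p v ≡ true) → count p ≡ n
count-full {zero}  p full = refl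
count-full {suc n} p full = cong₂ _+_ (cong b2n (full zero)) (count-full (p ∘ suc) (full ∘ suc))

count-≤ : ∀ {n} (p : VSet n) → count p ≤ n
count-≤ {n} p = ≤-trans (count-mono {p = p} {q = λ _ → true} λ _ _ → refl)
  (≤-reflexive (count-full {n} (λ _ → true) λ _ → refl))

count-single : ∀ {n} {p : VSet n} → (∀ u v → p u ≡ true → p v ≡ true → u ≡ v) → count p ≤ 1
count-single {zero}      uniq = z≤n
count-single {suc n} {p} uniq with p zero in p0
... | false = count-single (λ u v pu pv → suc-injective (uniq _ _ pu pv))
... | true  = s≤s (≤-reflexive (count-none (p ∘ suc) rest))
  where
  rest : ∀ v → p (suc v) ≡ false
  rest v = ¬-not λ pv → case uniq zero (suc v) p0 pv of λ ()

count-witness : ∀ {n} {p : VSet n} → 1 ≤ count p → ∃ λ v → p v ≡ true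
count-witness {suc n} {p} 1≤ with p zero in p0
... | true  = zero , p0
... | false with v , pv ← count-witness {p = p ∘ suc} 1≤ = suc v , pv

∣tabulate∣ : ∀ {n} (p : VSet n) → ∣ tabulate p ∣ ≡ count p
∣tabulate∣ {zero}  p = refl
∣tabulate∣ {suc n} p with p zero
... | true  = cong suc (∣tabulate∣ (p ∘ suc))
... | false = ∣tabulate∣ (p ∘ suc)

∣∣-lookup : ∀ {n} (s : Subset n) → ∣ s ∣ ≡ count (lookup s)
∣∣-lookup s = trans (cong ∣_∣ (≡-sym (tabulate∘lookup s))) (∣tabulate∣ (lookup s))

∈-tabulate⁺ : ∀ {n} {p : VSet n} {v} → p v ≡ true → v ∈ tabulate p
∈-tabulate⁺ {p = p} {v} pv = lookup⇒[]= v _ (trans (lookup∘tabulate p v) pv)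

∈-tabulate⁻ : ∀ {n} {p : VSet n} {v} → v ∈ tabulate p → p v ≡ true
∈-tabulate⁻ {p = p} {v} v∈ = trans (≡-sym (lookup∘tabulate p v)) ([]=⇒lookup v∈)

sum-allFin : ∀ {n} (f : Fin n → ℕ) → ListAction.sum (map f (allFin n)) ≡ ∑ f
sum-allFin f = trans (cong ListAction.sum (map-tabulate id f)) (sum-tabulate f)
  where
  sum-tabulate : ∀ {n} (f : Fin n → ℕ) → ListAction.sum (List.tabulate f) ≡ ∑ f
  sum-tabulate {zero}  f = refl
  sum-tabulate {suc n} f = cong (f zero +_) (sum-tabulate (f ∘ suc))

degree≤maxDegree : ∀ {n} (G : Graph n) v → degree G v ≤ maxDegree G
degree≤maxDegree {n} G v =
  subst (λ xs → degree G v ≤ foldr _⊔_ 0 xs) (≡-sym (map-tabulate id (degree G))) (max-tabulate _ v)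
  where
  max-tabulate : ∀ {n} (f : Fin n → ℕ) i → f i ≤ foldr _⊔_ 0 (List.tabulate f)
  max-tabulate f zero    = m≤m⊔n _ _
  max-tabulate f (suc i) = ≤-trans (max-tabulate (f ∘ suc) i) (m≤n⊔m _ _)

-- Edge bounds are carried in this form until the end: separators of several cuts are united, any
-- function of separated maps is separated by the union, and the degree enters only once, in
-- `crossEdges-≤`. The codomain is arbitrary so that sets and the final labelling are treated alike.
Separates : ∀ {n} {A : Set} → Graph n → VSet n → (Fin n → A) → Set
Separates G Q f = ∀ u v → adj G u v ≡ true → Q u ≡ false → Q v ≡ false → f u ≡ f v

-- Each crossing edge is charged to one of its ends in Q.
crossEdges-≤ : ∀ {n k} (G : Graph n) (f : Fin n → Fin k) (Q : VSet n) → Separates G Q f →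
               crossEdges G f ≤ count Q * maxDegree G
crossEdges-≤ {n} G f Q sep = begin
  crossEdges G f
    ≡⟨ trans (sum-allFin (λ u → ListAction.sum (map (cross u) (allFin n)))) (sum-cong-≗ {n} λ u → sum-allFin (cross u)) ⟩
  ∑ (λ u → ∑ (λ v → cross u v))
    ≤⟨ ∑-mono-≤ (λ u → ∑-mono-≤ (charge u)) ⟩
  ∑ (λ u → ∑ (λ v → out u v + into u v))
    ≡⟨ sum-cong-≗ (λ u → ∑-distrib-+ (out u) (into u)) ⟩
  ∑ (λ u → ∑ (out u) + ∑ (into u))
    ≡⟨ ∑-distrib-+ (λ u → ∑ (out u)) (λ u → ∑ (into u)) ⟩
  ∑ (λ u → ∑ (out u)) + ∑ (λ u → ∑ (into u))
    ≡⟨ cong (∑ (λ u → ∑ (out u)) +_) (∑-comm into) ⟩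
  ∑ (λ u → ∑ (out u)) + ∑ (λ v → ∑ (λ u → into u v))
    ≡⟨ ∑-distrib-+ (λ u → ∑ (out u)) _ ⟨
  ∑ (λ u → ∑ (out u) + ∑ (λ v → into v u))
    ≡⟨ sum-cong-≗ (λ u → ∑-distrib-+ (out u) (λ v → into v u)) ⟨
  ∑ (λ u → ∑ (λ v → out u v + into v u))
    ≤⟨ ∑-mono-≤ (λ u → ∑-mono-≤ (λ v → once u v)) ⟩
  ∑ (λ u → ∑ (λ v → b2n (adj G u v) * b2n (Q u)))
    ≡⟨ sum-cong-≗ (λ u → ∑-*-distribʳ (λ v → b2n (adj G u v)) (b2n (Q u))) ⟩
  ∑ (λ u → ∑ (λ v → b2n (adj G u v)) * b2n (Q u))
    ≤⟨ ∑-mono-≤ (λ u → *-monoˡ-≤ (b2n (Q u))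
         (≤-trans (≤-reflexive (≡-sym (sum-allFin (λ v → b2n (adj G u v))))) (degree≤maxDegree G u))) ⟩
  ∑ (λ u → maxDegree G * b2n (Q u))
    ≡⟨ sum-cong-≗ (λ u → *-comm (maxDegree G) (b2n (Q u))) ⟩
  ∑ (λ u → b2n (Q u) * maxDegree G)
    ≡⟨ ∑-*-distribʳ (b2n ∘ Q) (maxDegree G) ⟩
  count Q * maxDegree G ∎
  where
  open ≤-Reasoning
  cross out into : Fin n → Fin n → ℕ
  cross u v = b2n ((toℕ u <ᵇ toℕ v) ∧ adj G u v ∧ not ⌊ f u Fin.≟ f v ⌋)
  out u v = b2n ((toℕ u <ᵇ toℕ v) ∧ adj G u v ∧ Q u)
  into u v = b2n ((toℕ u <ᵇ toℕ v) ∧ adj G u v ∧ Q v)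

  charge : ∀ u v → cross u v ≤ out u v + into u v
  charge u v with toℕ u <ᵇ toℕ v | adj G u v in uv | Q u in Qu | Q v in Qv
  ... | false | _     | _     | _     = z≤n
  ... | true  | false | _     | _     = z≤n
  ... | true  | true  | true  | _     = ≤-trans (b2n≤1 _) (m≤m+n 1 _)
  ... | true  | true  | false | true  = b2n≤1 _
  ... | true  | true  | false | false =
    ≤-reflexive (cong (b2n ∘ not) (⌊⌋-true (f u Fin.≟ f v) (sep u v uv Qu Qv)))

  -- An edge charges `u` either as its smaller end or as its larger end, never as both.
  once : ∀ u v → out u v + into v u ≤ b2n (adj G u v) * b2n (Q u)
  once u v rewrite Graph.sym G v u with adj G u v | Q u
  ... | false | _     rewrite ∧-zeroʳ (toℕ u <ᵇ toℕ v) | ∧-zeroʳ (toℕ v <ᵇ toℕ u) = z≤n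
  ... | true  | false rewrite ∧-zeroʳ (toℕ u <ᵇ toℕ v) | ∧-zeroʳ (toℕ v <ᵇ toℕ u) = z≤n
  ... | true  | true  with toℕ u <ᵇ toℕ v in uv | toℕ v <ᵇ toℕ u in vu
  ... | false | b     = ≤-trans (b2n≤1 _) (s≤s z≤n)
  ... | true  | false = s≤s z≤n
  ... | true  | true  = contradiction (<ᵇ-true⇒< vu) (<-asym (<ᵇ-true⇒< {toℕ u} uv))

-- Rooted tree decompositions

module _ {k : ℕ} {T : Fin k → Fin k → Set} where

  single : Fin k → TPath T
  single i = record
    { len = 0 ; node = λ _ → i ; step = λ () ; inj = λ { {zero} {zero} _ → refl } }

  cons : (i : Fin k) (P : TPath T) → T i (first P) → (∀ h → node P h ≢ i) → TPath T
  cons i P e fresh = record { len = suc (len P) ; node = nd ; step = st ; inj = nd-inj }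
    where
    nd : Fin (suc (suc (len P))) → Fin k
    nd zero    = i
    nd (suc h) = node P h
    st : ∀ h → T (nd (inject₁ h)) (nd (suc h))
    st zero    = e
    st (suc h) = step P h
    nd-inj : ∀ {a b} → nd a ≡ nd b → a ≡ b
    nd-inj {zero}  {zero}  _  = refl
    nd-inj {zero}  {suc b} eq = contradiction (≡-sym eq) (fresh b)
    nd-inj {suc a} {zero}  eq = contradiction eq (fresh a)
    nd-inj {suc a} {suc b} eq = cong suc (inj P eq)

  opposite-inject₁ : ∀ {n} (h : Fin n) → opposite (inject₁ h) ≡ suc (opposite h)
  opposite-inject₁ zero    = refl
  opposite-inject₁ (suc h) = cong inject₁ (opposite-inject₁ h)

  opposite-fromℕ : ∀ n → opposite (fromℕ n) ≡ zero
  opposite-fromℕ zero    = refl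
  opposite-fromℕ (suc n) = cong inject₁ (opposite-fromℕ n)

  reversePath : (∀ i j → T i j → T j i) → TPath T → TPath T
  reversePath T-sym P = record
    { len  = len P
    ; node = node P ∘ opposite
    ; step = λ h → subst (λ x → T (node P x) (node P (inject₁ (opposite h))))
                     (≡-sym (opposite-inject₁ h)) (T-sym _ _ (step P (opposite h)))
    ; inj  = λ {a} {b} eq → trans (≡-sym (opposite-involutive a))
                              (trans (cong opposite (inj P eq)) (opposite-involutive b))
    }

  last-reverse : (T-sym : ∀ i j → T i j → T j i) (P : TPath T) →
                 last (reversePath T-sym P) ≡ first P
  last-reverse T-sym P = cong (node P) (opposite-fromℕ (len P))

-- Ancestors, and the passage from rooted to unrooted tree decompositions

module Ancestor (par : ℕ → ℕ) (par≤ : ∀ i → par (suc i) ≤ i) where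

  infix 4 _≼_
  data _≼_ (i : ℕ) : ℕ → Set where
    here : i ≼ i
    down : ∀ {j} → i ≼ par (suc j) → i ≼ suc j

  ≼⇒≤ : ∀ {i j} → i ≼ j → i ≤ j
  ≼⇒≤ here             = ≤-refl
  ≼⇒≤ (down {j} i≼p)   = ≤-trans (≼⇒≤ i≼p) (≤-trans (par≤ j) (n≤1+n j))

  ≼-trans : ∀ {i j l} → i ≼ j → j ≼ l → i ≼ l
  ≼-trans i≼j here       = i≼j
  ≼-trans i≼j (down j≼p) = down (≼-trans i≼j j≼p)

  ≼-linear : ∀ {i j l} → i ≼ l → j ≼ l → i ≼ j ⊎ j ≼ i
  ≼-linear here       j≼l        = inj₂ j≼l
  ≼-linear (down i≼p) here       = inj₁ (down i≼p)
  ≼-linear (down i≼p) (down j≼p) = ≼-linear i≼p j≼p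

  ≼-par : ∀ {i j} → i ≼ suc j → i ≢ suc j → i ≼ par (suc j)
  ≼-par here       i≢ = contradiction refl i≢
  ≼-par (down i≼p) _  = i≼p

  infix 4 _≼?_
  _≼?_ : ∀ i j → Dec (i ≼ j)
  i ≼? j = <-rec (λ j → Dec (i ≼ j)) dec j
    where
    dec : ∀ j → (∀ {l} → l < j → Dec (i ≼ l)) → Dec (i ≼ j)
    dec zero    rec = map′ (λ { refl → here }) (λ { here → refl }) (i ≟ 0)
    dec (suc j) rec with i ≟ suc j
    ... | yes refl = yes here
    ... | no i≢    = map′ down (λ i≼ → ≼-par i≼ i≢) (rec (s≤s (par≤ j)))

  0≼ : ∀ j → 0 ≼ j
  0≼ j = <-rec (0 ≼_) (λ { zero _ → here ; (suc j) rec → down (rec (s≤s (par≤ j))) }) j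

-- Nodes are the numbers below size and parents have smaller indices; par 0 is
-- junk. Coherence is the condition that each vertex occurs at a single node,
-- its top, without occurring at the parent.
record Rooted {n : ℕ} (G : Graph n) (S : VSet n) : Set where
  field
    size   : ℕ
    0<size : 0 < size
    par    : ℕ → ℕ
    par≤   : ∀ i → par (suc i) ≤ i
    X      : ℕ → VSet n
    X<size : ∀ {i v} → X i v ≡ true → i < size
    X⊆S    : ∀ {i v} → X i v ≡ true → S v ≡ true
    top    : Fin n → ℕ
    top∈   : ∀ {v} → S v ≡ true → X (top v) v ≡ true
    X-zero : ∀ {v} → X 0 v ≡ true → top v ≡ 0
    X-suc  : ∀ {i v} → X (suc i) v ≡ true → top v ≡ suc i ⊎ X (par (suc i)) v ≡ true
    common : ∀ {u v} → S u ≡ true → S v ≡ true → adj G u v ≡ true →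
             ∃ λ i → X i u ≡ true × X i v ≡ true

module RootedProperties {n : ℕ} {G : Graph n} {S : VSet n} (R : Rooted G S) where
  open Rooted R public
  open Ancestor par par≤ public

  top≼ : ∀ {i v} → X i v ≡ true → top v ≼ i
  top≼ {i} {v} = <-rec (λ i → X i v ≡ true → top v ≼ i) rec i
    where
    rec : ∀ i → (∀ {l} → l < i → X l v ≡ true → top v ≼ l) → X i v ≡ true → top v ≼ i
    rec zero    _  v∈ = subst (_≼ 0) (≡-sym (X-zero v∈)) here
    rec (suc i) ih v∈ with X-suc v∈
    ... | inj₁ eq  = subst (_≼ suc i) (≡-sym eq) here
    ... | inj₂ v∈p = down (ih (s≤s (par≤ i)) v∈p)

  -- On the climb from `j` to `i`, `v` is passed on to each parent until either `i` or the top of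
  -- `v` is met.
  X-between : ∀ {i j v} → X j v ≡ true → i ≼ j → X i v ≡ true ⊎ i ≼ top v
  X-between v∈ here = inj₁ v∈
  X-between v∈ (down i≼p) with X-suc v∈
  ... | inj₁ eq  = inj₂ (subst (_ ≼_) (≡-sym eq) (down i≼p))
  ... | inj₂ v∈p = X-between v∈p i≼p

  X-interval : ∀ {i j v} → S v ≡ true → X j v ≡ true → i ≼ j → top v ≼ i → X i v ≡ true
  X-interval {i} {v = v} v∈S v∈ i≼j t≼i with X-between v∈ i≼j
  ... | inj₁ v∈i = v∈i
  ... | inj₂ i≼t = subst (λ i → X i v ≡ true) (≤-antisym (≼⇒≤ t≼i) (≼⇒≤ i≼t)) (top∈ v∈S)

  -- Both tops are ancestors of a common bag, hence comparable. The lower top lies between that bag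
  -- and the other top, so its bag contains both ends.
  edge-top : ∀ {u v} → S u ≡ true → S v ≡ true → adj G u v ≡ true →
             X (top v) u ≡ true ⊎ X (top u) v ≡ true
  edge-top u∈S v∈S uv with i , u∈ , v∈ ← common u∈S v∈S uv with ≼-linear (top≼ u∈) (top≼ v∈)
  ... | inj₁ u≼v = inj₁ (X-interval u∈S u∈ (top≼ v∈) u≼v)
  ... | inj₂ v≼u = inj₂ (X-interval v∈S v∈ (top≼ u∈) v≼u)

  Child : Fin size → Fin size → Set
  Child i j = ∃ λ j′ → toℕ j ≡ suc j′ × toℕ i ≡ par (suc j′)

  Adj : Fin size → Fin size → Set
  Adj i j = Child i j ⊎ Child j i

  Child-< : ∀ {i j} → Child i j → toℕ i < toℕ j
  Child-< (j′ , eq , eq′) = subst₂ _<_ (≡-sym eq′) (≡-sym eq) (s≤s (par≤ j′))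

  Child-≼ : ∀ {i j l} → Child i j → l ≼ toℕ i → l ≼ toℕ j
  Child-≼ (j′ , eq , eq′) l≼i = subst (_ ≼_) (≡-sym eq) (down (subst (_ ≼_) eq′ l≼i))

  Child-≽ : ∀ {i j l} → Child i j → l ≼ toℕ j → l ≢ toℕ j → l ≼ toℕ i
  Child-≽ (j′ , eq , eq′) l≼j l≢j =
    subst (_ ≼_) (≡-sym eq′) (≼-par (subst (_ ≼_) eq l≼j) (λ l≡ → l≢j (trans l≡ (≡-sym eq))))

  Child-unique : ∀ {i i′ j} → Child i j → Child i′ j → i ≡ i′
  Child-unique (a , eq , e) (b , eq′ , e′) with refl ← trans (≡-sym eq) eq′ =
    toℕ-injective (trans e (≡-sym e′))

  Adj-sym : ∀ i j → Adj i j → Adj j i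
  Adj-sym i j (inj₁ c) = inj₂ c
  Adj-sym i j (inj₂ c) = inj₁ c

  -- A walk can enter the descendants of a, or leave them, only through a and
  -- its parent.
  no-entry : ∀ m (nd : Fin (suc m) → Fin size) → (∀ h → Adj (nd (inject₁ h)) (nd (suc h))) →
             ∀ a → (∀ h → a ≢ toℕ (nd h)) → a ≼ toℕ (nd (fromℕ m)) → a ≼ toℕ (nd zero)
  no-entry zero    nd st a avoid a≼ = a≼
  no-entry (suc m) nd st a avoid a≼ with no-entry m (nd ∘ suc) (st ∘ suc) a (avoid ∘ suc) a≼ | st zero
  ... | a≼1 | inj₁ c = Child-≽ c a≼1 (avoid (suc zero))
  ... | a≼1 | inj₂ c = Child-≼ c a≼1

  no-exit : ∀ m (nd : Fin (suc m) → Fin size) → (∀ h → Adj (nd (inject₁ h)) (nd (suc h))) →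
            ∀ {p a} → Child p a → (∀ h → nd h ≢ p) → toℕ a ≼ toℕ (nd zero) → toℕ a ≼ toℕ (nd (fromℕ m))
  no-exit zero    nd st pa avoid a≼ = a≼
  no-exit (suc m) nd st {p} {a} pa avoid a≼ =
    no-exit m (nd ∘ suc) (st ∘ suc) pa (avoid ∘ suc) (next (st zero))
    where
    next : Adj (nd zero) (nd (suc zero)) → toℕ a ≼ toℕ (nd (suc zero))
    next (inj₁ c) = Child-≼ c a≼
    next (inj₂ c) with a Fin.≟ nd zero
    ... | yes refl = contradiction (Child-unique c pa) (avoid (suc zero))
    ... | no a≢    = Child-≽ c a≼ (a≢ ∘ toℕ-injective)

  -- The end of larger index is replaced by its parent, which lowers the sum of the indices bounded
  -- by `s`. The bound on the indices along the path is what makes the prepended node fresh.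
  tree-connected : ∀ s (i j : Fin size) → toℕ i + toℕ j ≤ s →
    Σ (TPath Adj) λ P → first P ≡ i × last P ≡ j × (∀ h → toℕ (node P h) ≤ toℕ i ⊎ toℕ (node P h) ≤ toℕ j)
  parent-step : ∀ s (i j : Fin size) → toℕ i + toℕ j ≤ s → toℕ j < toℕ i →
    Σ (TPath Adj) λ P → first P ≡ i × last P ≡ j × (∀ h → toℕ (node P h) ≤ toℕ i)

  tree-connected s i j i+j≤s with <-cmp (toℕ i) (toℕ j)
  ... | tri≈ _ i≡j _ = single i , refl , toℕ-injective i≡j , λ _ → inj₁ ≤-refl
  ... | tri> _ _ j<i with P , fst , lst , bd ← parent-step s i j i+j≤s j<i =
    P , fst , lst , inj₁ ∘ bd
  ... | tri< i<j _ _ with P , fst , lst , bd ← parent-step s j i (subst (_≤ s) (+-comm (toℕ i) _) i+j≤s) i<j =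
    reversePath Adj-sym P , lst , trans (last-reverse Adj-sym P) fst , λ h → inj₂ (bd (opposite h))

  parent-step s i j i+j≤s j<i = attach s i+j≤s (toℕ i) refl
    where
    attach : ∀ s → toℕ i + toℕ j ≤ s → ∀ i″ → toℕ i ≡ i″ →
      Σ (TPath Adj) λ P → first P ≡ i × last P ≡ j × (∀ h → toℕ (node P h) ≤ toℕ i)
    attach s       _   zero     eq with () ← subst (toℕ j <_) eq j<i
    attach zero    i+j (suc i′) eq with () ← subst (_≤ 0) eq (m+n≤o⇒m≤o (toℕ i) i+j)
    attach (suc s) i+j (suc i′) eq = extend (tree-connected s p j p+j≤s)
      where
      p<size : par (suc i′) < size
      p<size = ≤-<-trans (par≤ i′) (<-trans (n<1+n i′) (subst (_< size) eq (toℕ<n i)))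
      p : Fin size
      p = fromℕ< p<size
      p≤i′ : toℕ p ≤ i′
      p≤i′ = subst (_≤ i′) (≡-sym (toℕ-fromℕ< p<size)) (par≤ i′)
      p+j≤s : toℕ p + toℕ j ≤ s
      p+j≤s = ≤-trans (+-monoˡ-≤ (toℕ j) p≤i′) (≤-pred (subst (λ x → x + toℕ j ≤ suc s) eq i+j))
      below : ∀ {x} → x ≤ toℕ p ⊎ x ≤ toℕ j → x < toℕ i
      below (inj₁ x≤p) = subst (_ <_) (≡-sym eq) (s≤s (≤-trans x≤p p≤i′))
      below (inj₂ x≤j) = ≤-<-trans x≤j j<i
      extend : (Σ (TPath Adj) λ P → first P ≡ p × last P ≡ j ×
                  (∀ h → toℕ (node P h) ≤ toℕ p ⊎ toℕ (node P h) ≤ toℕ j)) →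
               Σ (TPath Adj) λ P → first P ≡ i × last P ≡ j × (∀ h → toℕ (node P h) ≤ toℕ i)
      extend (P , fst , lst , bd) =
        cons i P (inj₂ (i′ , eq , trans (cong toℕ fst) (toℕ-fromℕ< p<size)))
          (λ h e → <-irrefl (cong toℕ e) (below (bd h))) ,
        refl , lst , λ { zero → ≤-refl ; (suc h) → <⇒≤ (below (bd h)) }

  -- Suppose the cycle first goes up from its start. It cannot return from the parent, which is
  -- already used, nor from a child, since the rest of the path would have to enter the descendants
  -- of the start without passing it. If it first goes down, the rest stays below that child,
  -- whereas the closing edge comes from the parent of the start or from another child.
  tree-acyclic : ∀ (P : TPath Adj) → 2 ≤ len P → ¬ Adj (last P) (first P)
  tree-acyclic record { len = suc zero } (s≤s ())
  tree-acyclic record { len = suc (suc m) ; node = nd ; step = st ; inj = nd-inj } _ closing = cycle (st zero) closing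
    where
    avoid : ∀ h → nd (suc h) ≢ nd zero
    avoid h eq = case nd-inj eq of λ ()
    cycle : Adj (nd zero) (nd (suc zero)) → Adj (nd (fromℕ (suc (suc m)))) (nd zero) → _
    cycle (inj₂ c) (inj₁ c′) = case nd-inj (Child-unique c c′) of λ ()
    cycle (inj₂ c) (inj₂ c′) = <⇒≱ (Child-< c)
      (≼⇒≤ (no-entry (suc m) (nd ∘ suc) (st ∘ suc) (toℕ (nd zero))
        (λ h eq → avoid h (toℕ-injective (≡-sym eq))) (Child-≼ c′ here)))
    cycle (inj₁ c) closing = leave closing
      where
      a≼end : toℕ (nd (suc zero)) ≼ toℕ (nd (suc (fromℕ (suc m))))
      a≼end = no-exit (suc m) (nd ∘ suc) (st ∘ suc) c avoid here
      leave : Adj (nd (fromℕ (suc (suc m)))) (nd zero) → _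
      leave (inj₁ c′) = <⇒≱ (<-trans (Child-< c′) (Child-< c)) (≼⇒≤ a≼end)
      leave (inj₂ c′) = <⇒≱ (Child-< c) (≼⇒≤ (Child-≽ c′ a≼end
        λ eq → case nd-inj {suc zero} {suc (suc (fromℕ m))} (toℕ-injective eq) of λ ()))

  -- A first step up keeps `v` unless the start is its top; but then the last node is a descendant
  -- of the start, which the remaining path could not reach. After a first step down the last node
  -- lies below that child, so `v` is met at the child on the climb to its top.
  tree-coherent : ∀ m (nd : Fin (suc m) → Fin size) → (∀ h → Adj (nd (inject₁ h)) (nd (suc h))) →
                  (∀ {a b} → nd a ≡ nd b → a ≡ b) → ∀ {v} → X (toℕ (nd zero)) v ≡ true →
                  X (toℕ (nd (fromℕ m))) v ≡ true → ∀ h → X (toℕ (nd h)) v ≡ true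
  tree-coherent m nd st nd-inj v∈0 v∈m zero = v∈0
  tree-coherent (suc m) nd st nd-inj {v} v∈0 v∈m (suc h) =
    tree-coherent m (nd ∘ suc) (st ∘ suc) (suc-injective ∘ nd-inj) (next (st zero)) v∈m h
    where
    avoid : ∀ h → nd (suc h) ≢ nd zero
    avoid h eq = case nd-inj eq of λ ()
    next : Adj (nd zero) (nd (suc zero)) → X (toℕ (nd (suc zero))) v ≡ true
    next (inj₂ c@(i , eq , eq′)) with X-suc (subst (λ i → X i v ≡ true) eq v∈0)
    ... | inj₂ v∈p = subst (λ i → X i v ≡ true) (≡-sym eq′) v∈p
    ... | inj₁ t≡  = contradiction
      (≼⇒≤ (no-entry m (nd ∘ suc) (st ∘ suc) (toℕ (nd zero))
        (λ h eq → avoid h (toℕ-injective (≡-sym eq)))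
        (subst (_≼ _) (trans t≡ (≡-sym eq)) (top≼ v∈m))))
      (<⇒≱ (Child-< c))
    next (inj₁ c) with X-between v∈m (no-exit m (nd ∘ suc) (st ∘ suc) c avoid here)
    ... | inj₁ v∈1 = v∈1
    ... | inj₂ 1≼t = contradiction (≤-trans (≼⇒≤ 1≼t) (≼⇒≤ (top≼ v∈0))) (<⇒≱ (Child-< c))

  treeDec : TreeDec G (tabulate S)
  treeDec = record
    { k = size
    ; T = Adj
    ; isTree = record
      { nonempty  = 0<size
      ; symmetric = Adj-sym
      ; irreflex  = λ { i (inj₁ c) → <-irrefl refl (Child-< c) ; i (inj₂ c) → <-irrefl refl (Child-< c) }
      ; connected = λ i j → let P , fst , lst , _ = tree-connected _ i j ≤-refl in P , fst , lst
      ; acyclic   = tree-acyclic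
      }
    ; bag   = λ i → tabulate (X (toℕ i))
    ; bag⊆S = λ i v∈ → ∈-tabulate⁺ (X⊆S (∈-tabulate⁻ v∈))
    ; cover = λ v v∈ → let v∈t = top∈ (∈-tabulate⁻ v∈) in fromℕ< (X<size v∈t) , in-bag v∈t
    ; edges = λ u v u∈ v∈ uv →
        let i , u∈i , v∈i = common (∈-tabulate⁻ u∈) (∈-tabulate⁻ v∈) uv
        in fromℕ< (X<size u∈i) , in-bag′ (X<size u∈i) u∈i , in-bag′ (X<size u∈i) v∈i
    ; coh   = λ P h v∈ → let v∈0 , v∈m = x∈p∩q⁻ _ _ v∈ in
        ∈-tabulate⁺ (tree-coherent (len P) (node P) (step P) (inj P) (∈-tabulate⁻ v∈0) (∈-tabulate⁻ v∈m) h)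
    }
    where
    in-bag′ : ∀ {i v} (i< : i < size) → X i v ≡ true → v ∈ tabulate (X (toℕ (fromℕ< i<)))
    in-bag′ {v = v} i< v∈ = ∈-tabulate⁺ (subst (λ i → X i v ≡ true) (≡-sym (toℕ-fromℕ< i<)) v∈)
    in-bag : ∀ {i v} (v∈ : X i v ≡ true) → v ∈ tabulate (X (toℕ (fromℕ< (X<size v∈))))
    in-bag v∈ = in-bag′ (X<size v∈) v∈

-- A spanning tree grown from P

least : ∀ {Q : ℕ → Set} → (∀ i → Dec (Q i)) → ∀ b → Q b →
        ∃ λ i → Q i × i ≤ b × (∀ a → a < i → ¬ Q a)
least Q? zero    q = 0 , q , z≤n , λ a ()
least Q? (suc b) q with Q? 0
... | yes q0 = 0 , q0 , z≤n , λ a ()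
... | no ¬q0 with i , qi , i≤b , below ← least (Q? ∘ suc) b q =
  suc i , qi , s≤s i≤b , λ { zero _ → ¬q0 ; (suc a) (s≤s a<i) → below a a<i }

crossing : ∀ {A : Set} {Q : A → Set} → (∀ x → Dec (Q x)) → ∀ m (nd : Fin (suc m) → A) →
           Q (nd zero) → ¬ Q (nd (fromℕ m)) → ∃ λ (h : Fin m) → Q (nd (inject₁ h)) × ¬ Q (nd (suc h))
crossing Q? zero    nd q ¬q = contradiction q ¬q
crossing Q? (suc m) nd q ¬q with Q? (nd (suc zero))
... | no ¬q1 = zero , q , ¬q1
... | yes q1 with h , qh , ¬qh ← crossing Q? m (nd ∘ suc) q1 ¬q = suc h , qh , ¬qh

module Spanning {n : ℕ} {G : Graph n} (D : TreeDec G ⊤) (P : TPath (T D)) where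
  open IsTree (isTree D) using (symmetric; connected)

  ℓ : ℕ
  ℓ = len P

  Reached : ℕ → (ℕ → Fin (k D)) → Fin (k D) → Set
  Reached N ν x = ∃ λ a → a < N × ν a ≡ x

  -- A subtree ν 0, …, ν (N − 1) of T that contains P as an initial segment. Since
  -- a new node is reached from any old one through its parent, coherence of D
  -- yields local; the values of ν and par from N on are junk.
  record Grown (N : ℕ) : Set where
    field
      ν     : ℕ → Fin (k D)
      par   : ℕ → ℕ
      par≤  : ∀ i → par (suc i) ≤ i
      ν-inj : ∀ {i j} → i < N → j < N → ν i ≡ ν j → i ≡ j
      conn  : ∀ {x y} → Reached N ν x → Reached N ν y →
              Σ (TPath (T D)) λ Q → first Q ≡ x × last Q ≡ y × (∀ h → Reached N ν (node Q h))
      local : ∀ {i a v} → suc i < N → a ≤ i → v ∈ bag D (ν (suc i)) → v ∈ bag D (ν a) →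
              v ∈ bag D (ν (par (suc i)))
      onP   : ∀ (h : Fin (suc ℓ)) → toℕ h < N → ν (toℕ h) ≡ node P h
      spine : ∀ i → suc i < N → suc i ≤ ℓ → par (suc i) ≡ i

  initial : Grown 1
  initial = record
    { ν     = λ _ → first P
    ; par   = λ _ → 0
    ; par≤  = λ _ → z≤n
    ; ν-inj = λ { (s≤s z≤n) (s≤s z≤n) _ → refl }
    ; conn  = λ { (_ , _ , eq) (_ , _ , eq′) → single (first P) , eq , eq′ , λ _ → 0 , s≤s z≤n , refl }
    ; local = λ { (s≤s ()) }
    ; onP   = λ { zero _ → refl ; (suc h) (s≤s ()) }
    ; spine = λ { i (s≤s ()) }
    }

  -- The hypothesis `along` has content only while `P` is being laid down: the new node is then the
  -- next node of `P`, attached to the one adjoined last.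
  module Extend {N : ℕ} (g : Grown N) {p : ℕ} (p<N : p < N) {y : Fin (k D)}
                (new : ¬ Reached N (Grown.ν g) y) (edge : T D (Grown.ν g p) y)
                (along : N ≤ ℓ → suc p ≡ N × (∀ h → toℕ h ≡ N → node P h ≡ y)) where
    open Grown g

    ν′ : ℕ → Fin (k D)
    ν′ i = if i <ᵇ N then ν i else y

    par′ : ℕ → ℕ
    par′ i = if i <ᵇ N then par i else p

    ν′-old : ∀ {i} → i < N → ν′ i ≡ ν i
    ν′-old i<N rewrite <⇒<ᵇ-true i<N = refl

    ν′-new : ∀ {i} → i ≡ N → ν′ i ≡ y
    ν′-new {i} refl rewrite ≥⇒<ᵇ-false (≤-refl {N}) = refl

    par′-old : ∀ {i} → i < N → par′ i ≡ par i
    par′-old i<N rewrite <⇒<ᵇ-true i<N = refl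

    par′-new : ∀ {i} → i ≡ N → par′ i ≡ p
    par′-new refl rewrite ≥⇒<ᵇ-false (≤-refl {N}) = refl

    par′≤ : ∀ i → par′ (suc i) ≤ i
    par′≤ i with suc i <ᵇ N in eq
    ... | true  = par≤ i
    ... | false = ≤-pred (≤-trans p<N (<ᵇ-false⇒≥ eq))

    old : ∀ {x} → Reached N ν x → Reached (suc N) ν′ x
    old (a , a<N , eq) = a , <-trans a<N (n<1+n N) , trans (ν′-old a<N) eq

    y-reached : Reached (suc N) ν′ y
    y-reached = N , n<1+n N , ν′-new refl

    old? : ∀ {x} → Reached (suc N) ν′ x → Reached N ν x ⊎ x ≡ y
    old? (a , a< , eq) with m<1+n⇒m<n∨m≡n a<
    ... | inj₁ a<N = inj₁ (a , a<N , trans (≡-sym (ν′-old a<N)) eq)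
    ... | inj₂ a≡N = inj₂ (trans (≡-sym eq) (ν′-new a≡N))

    from-y : ∀ {x} → Reached N ν x →
             Σ (TPath (T D)) λ Q → first Q ≡ y × last Q ≡ x × (∀ h → Reached (suc N) ν′ (node Q h)) ×
               (∀ {v} → v ∈ bag D y → v ∈ bag D x → v ∈ bag D (ν p))
    from-y {x} rx with Q , fst , lst , inside ← conn (p , p<N , refl) rx =
      Q′ , refl , lst , (λ { zero → y-reached ; (suc h) → old (inside h) }) ,
      λ {v} v∈y v∈x → subst (λ z → v ∈ bag D z) fst
        (coh D Q′ (suc zero) (x∈p∩q⁺ (v∈y , subst (λ z → v ∈ bag D z) (≡-sym lst) v∈x)))
      where
      Q′ : TPath (T D)
      Q′ = cons y Q (symmetric _ _ (subst (λ z → T D z y) (≡-sym fst) edge))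
             λ h eq → new (subst (Reached N ν) eq (inside h))

    conn′ : ∀ {x z} → Reached (suc N) ν′ x → Reached (suc N) ν′ z →
            Σ (TPath (T D)) λ Q → first Q ≡ x × last Q ≡ z × (∀ h → Reached (suc N) ν′ (node Q h))
    conn′ rx rz with old? rx | old? rz
    ... | inj₁ ox | inj₁ oz with Q , fst , lst , inside ← conn ox oz = Q , fst , lst , old ∘ inside
    ... | inj₂ refl | inj₁ oz with Q , fst , lst , inside , _ ← from-y oz = Q , fst , lst , inside
    ... | inj₁ ox | inj₂ refl with Q , fst , lst , inside , _ ← from-y ox =
      reversePath symmetric Q , lst , trans (last-reverse symmetric Q) fst , inside ∘ opposite
    ... | inj₂ refl | inj₂ refl = single _ , refl , refl , λ _ → y-reached

    ν′-inj : ∀ {i j} → i < suc N → j < suc N → ν′ i ≡ ν′ j → i ≡ j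
    ν′-inj i< j< eq with m<1+n⇒m<n∨m≡n i< | m<1+n⇒m<n∨m≡n j<
    ... | inj₁ i<N | inj₁ j<N = ν-inj i<N j<N (trans (≡-sym (ν′-old i<N)) (trans eq (ν′-old j<N)))
    ... | inj₁ i<N | inj₂ j≡N = contradiction (_ , i<N , trans (≡-sym (ν′-old i<N)) (trans eq (ν′-new j≡N))) new
    ... | inj₂ i≡N | inj₁ j<N = contradiction (_ , j<N , trans (≡-sym (ν′-old j<N)) (trans (≡-sym eq) (ν′-new i≡N))) new
    ... | inj₂ i≡N | inj₂ j≡N = trans i≡N (≡-sym j≡N)

    local′ : ∀ {i a v} → suc i < suc N → a ≤ i → v ∈ bag D (ν′ (suc i)) → v ∈ bag D (ν′ a) →
             v ∈ bag D (ν′ (par′ (suc i)))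
    local′ {i} {a} {v} i< a≤i v∈i v∈a with m<1+n⇒m<n∨m≡n i<
    ... | inj₁ i<N rewrite par′-old i<N | ν′-old i<N | ν′-old (≤-<-trans a≤i (<⇒≤ i<N))
                         | ν′-old (≤-<-trans (par≤ i) (<⇒≤ i<N)) = local i<N a≤i v∈i v∈a
    ... | inj₂ i≡N rewrite par′-new i≡N | ν′-new i≡N | ν′-old p<N
                         | ν′-old (≤-<-trans a≤i (≤-reflexive i≡N))
      with _ , _ , _ , _ , meet ← from-y (a , ≤-<-trans a≤i (≤-reflexive i≡N) , refl) = meet v∈i v∈a

    onP′ : ∀ (h : Fin (suc ℓ)) → toℕ h < suc N → ν′ (toℕ h) ≡ node P h
    onP′ h h< with m<1+n⇒m<n∨m≡n h<
    ... | inj₁ h<N = trans (ν′-old h<N) (onP h h<N)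
    ... | inj₂ h≡N = trans (ν′-new h≡N)
      (≡-sym (proj₂ (along (subst (_≤ ℓ) h≡N (≤-pred (toℕ<n h)))) h h≡N))

    spine′ : ∀ i → suc i < suc N → suc i ≤ ℓ → par′ (suc i) ≡ i
    spine′ i i< i≤ℓ with m<1+n⇒m<n∨m≡n i<
    ... | inj₁ i<N = trans (par′-old i<N) (spine i i<N i≤ℓ)
    ... | inj₂ i≡N = trans (par′-new i≡N)
      (cong pred (trans (proj₁ (along (subst (_≤ ℓ) i≡N i≤ℓ))) (≡-sym i≡N)))

    extended : Grown (suc N)
    extended = record
      { ν = ν′ ; par = par′ ; par≤ = par′≤ ; ν-inj = ν′-inj ; conn = conn′
      ; local = local′ ; onP = onP′ ; spine = spine′ }

  grown≤k : ∀ {N} → Grown N → N ≤ k D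
  grown≤k g = injective⇒≤ {f = Grown.ν g ∘ toℕ}
    λ {a} {b} eq → toℕ-injective (Grown.ν-inj g (toℕ<n a) (toℕ<n b) eq)

  reached? : ∀ N ν x → Dec (Reached N ν x)
  reached? N ν x = map′ (λ (a , eq) → toℕ a , toℕ<n a , eq)
    (λ (a , a<N , eq) → fromℕ< a<N , trans (cong ν (toℕ-fromℕ< a<N)) eq)
    (any? {n = N} λ a → ν (toℕ a) Fin.≟ x)

  -- Once `P` is exhausted, a path of `T` from the root to an unreached node has a first edge that
  -- leaves the subtree, and this edge is adjoined. The fuel `f` cannot run out because the adjoined
  -- nodes are distinct nodes of `T`.
  grow : ∀ f {N} → suc N + f ≡ suc (k D) → Grown (suc N) →
         ∃ λ M → suc ℓ ≤ suc M × Σ (Grown (suc M)) λ g → ∀ x → Reached (suc M) (Grown.ν g) x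
  grow zero {N} eq g =
    contradiction (≤-trans (≤-reflexive (trans (≡-sym eq) (+-identityʳ (suc N)))) (grown≤k g)) 1+n≰n
  grow (suc f) {N} eq g with suc N ≤? ℓ
  ... | yes N<ℓ = grow f (trans (≡-sym (+-suc (suc N) f)) eq)
    (Extend.extended g (n<1+n N) new
      (subst (λ z → T D z (node P (suc h))) (≡-sym νN) (step P h))
      (λ _ → refl , λ h′ h′≡ → cong (node P) (toℕ-injective (trans h′≡ (cong suc (≡-sym (toℕ-fromℕ< N<ℓ)))))))
    where
    open Grown g
    h : Fin ℓ
    h = fromℕ< N<ℓ
    toℕ-h : toℕ (inject₁ h) ≡ N
    toℕ-h = trans (toℕ-inject₁ h) (toℕ-fromℕ< N<ℓ)
    νN : ν N ≡ node P (inject₁ h)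
    νN = trans (cong ν (≡-sym toℕ-h)) (onP (inject₁ h) (s≤s (≤-reflexive toℕ-h)))
    new : ¬ Reached (suc N) ν (node P (suc h))
    new (a , a≤N , νa) = <-irrefl (trans (≡-sym (toℕ-fromℕ< a<)) (trans (cong toℕ same) (cong suc (toℕ-fromℕ< N<ℓ)))) a≤N
      where
      a< : a < suc ℓ
      a< = <-trans a≤N (s≤s N<ℓ)
      same : fromℕ< a< ≡ suc h
      same = inj P (trans (≡-sym (onP (fromℕ< a<) (subst (_< suc N) (≡-sym (toℕ-fromℕ< a<)) a≤N)))
                     (trans (cong ν (toℕ-fromℕ< a<)) νa))
  ... | no N≮ℓ with any? (λ x → ¬? (reached? (suc N) (Grown.ν g) x))
  ...   | no all = N , ≰⇒> N≮ℓ , g , λ x → case reached? (suc N) (Grown.ν g) x of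
            λ { (yes r) → r ; (no ¬r) → contradiction (x , ¬r) all }
  ...   | yes (x , ¬r) with Q , fst , lst ← connected (Grown.ν g 0) x
    with h , (p , p< , νp) , new ← crossing (reached? (suc N) (Grown.ν g)) (len Q) (node Q)
           (0 , s≤s z≤n , ≡-sym fst) (subst (λ z → ¬ Reached (suc N) (Grown.ν g) z) (≡-sym lst) ¬r) =
    grow f (trans (≡-sym (+-suc (suc N) f)) eq)
      (Extend.extended g p< new (subst (λ z → T D z (node Q (suc h))) (≡-sym νp) (step Q h))
        (λ N≤ℓ → contradiction N≤ℓ N≮ℓ))

  record SpineRooted : Set where
    field
      rooted   : Rooted G (λ _ → true)
      spine    : ∀ i → suc i ≤ ℓ → Rooted.par rooted (suc i) ≡ i
      onP      : ∀ (h : Fin (suc ℓ)) {v} → v ∈ bag D (node P h) → Rooted.X rooted (toℕ h) v ≡ true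
      X-bag    : ∀ i → (∃ λ j → ∀ v → Rooted.X rooted i v ≡ true → v ∈ bag D j)

  opaque
    spineRooted : SpineRooted
    spineRooted with M , ℓ<M , g , all ← grow (k D) refl initial = record
      { rooted = record
        { size   = suc M
        ; 0<size = s≤s z≤n
        ; par    = par
        ; par≤   = par≤
        ; X      = X
        ; X<size = proj₁ ∘ X⁻
        ; X⊆S    = λ _ → refl
        ; top    = top
        ; top∈   = λ {v} _ → X⁺ (proj₁ (proj₁ (proj₂ (top′ v)))) (proj₂ (proj₁ (proj₂ (top′ v))))
        ; X-zero = λ {v} v∈ → n≤0⇒n≡0 (top-least (X⁻ v∈))
        ; X-suc  = X-suc
        ; common = λ {u} {v} _ _ uv →
            let j , u∈ , v∈ = edges D u v ∈⊤ ∈⊤ uv ; a , a< , νa = all j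
            in a , X⁺ a< (subst (λ z → u ∈ bag D z) (≡-sym νa) u∈)
                 , X⁺ a< (subst (λ z → v ∈ bag D z) (≡-sym νa) v∈)
        }
      ; spine = λ i i≤ℓ → Grown.spine g i (≤-trans (s≤s i≤ℓ) ℓ<M) i≤ℓ
      ; onP   = λ h {v} v∈ → X⁺ (≤-trans (toℕ<n h) ℓ<M)
                  (subst (λ z → v ∈ bag D z) (≡-sym (Grown.onP g h (≤-trans (toℕ<n h) ℓ<M))) v∈)
      ; X-bag = λ i → ν i , λ v v∈ → proj₂ (X⁻ v∈)
      }
      where
      open Grown g hiding (spine; onP)
      X : ℕ → VSet n
      X i v = (i <ᵇ suc M) ∧ lookup (bag D (ν i)) v

      X⁻ : ∀ {i v} → X i v ≡ true → i < suc M × v ∈ bag D (ν i)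
      X⁻ {i} {v} v∈ with i< , v∈i ← ∧-true v∈ = <ᵇ-true⇒< i< , lookup⇒[]= v _ v∈i

      X⁺ : ∀ {i v} → i < suc M → v ∈ bag D (ν i) → X i v ≡ true
      X⁺ i< v∈ = ∧-true⁺ (<⇒<ᵇ-true i<) ([]=⇒lookup v∈)

      In : Fin n → ℕ → Set
      In v i = i < suc M × v ∈ bag D (ν i)

      -- The least index is the right choice of top: by `local`, a node of larger index that
      -- contains `v` shares `v` with its parent.
      top′ : ∀ v → ∃ λ i → In v i × (∀ a → a < i → ¬ In v a)
      top′ v with j , v∈ ← cover D v ∈⊤ with a , a< , νa ← all j =
        let i , in-i , _ , low = least in? a (a< , subst (λ z → v ∈ bag D z) (≡-sym νa) v∈)
        in i , in-i , low
        where
        in? : ∀ i → Dec (In v i)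
        in? i = (i <? suc M) ×-dec (v ∈? bag D (ν i))

      top : Fin n → ℕ
      top v = proj₁ (top′ v)

      top-least : ∀ {v i} → In v i → top v ≤ i
      top-least {v} {i} v∈ = ≮⇒≥ λ i<t → proj₂ (proj₂ (top′ v)) i i<t v∈

      X-suc : ∀ {i v} → X (suc i) v ≡ true → top v ≡ suc i ⊎ X (par (suc i)) v ≡ true
      X-suc {i} {v} v∈ with m≤n⇒m<n∨m≡n (top-least (X⁻ v∈))
      ... | inj₂ eq  = inj₁ eq
      ... | inj₁ t≤i = inj₂ (X⁺ (≤-<-trans (par≤ i) (<-trans (n<1+n i) (proj₁ (X⁻ v∈))))
        (local (proj₁ (X⁻ v∈)) (≤-pred t≤i) (proj₂ (X⁻ v∈)) (proj₂ (proj₁ (proj₂ (top′ v))))))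

-- Restriction to an induced subgraph

∈-⋃⁺ : ∀ {n m} (f : Fin m → Subset n) {v} h → v ∈ f h → v ∈ ⋃ (map f (allFin m))
∈-⋃⁺ f {v} h v∈ = subst (λ xs → v ∈ ⋃ xs) (≡-sym (map-tabulate id f)) (go f h v∈)
  where
  go : ∀ {m} (f : Fin m → Subset _) h → v ∈ f h → v ∈ ⋃ (List.tabulate f)
  go f zero    v∈ = x∈p∪q⁺ (inj₁ v∈)
  go f (suc h) v∈ = x∈p∪q⁺ (inj₂ (go (f ∘ suc) h v∈))

∈-⋃⁻ : ∀ {n m} (f : Fin m → Subset n) {v} → v ∈ ⋃ (map f (allFin m)) → ∃ λ h → v ∈ f h
∈-⋃⁻ f {v} v∈ = go f (subst (λ xs → v ∈ ⋃ xs) (map-tabulate id f) v∈)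
  where
  go : ∀ {m} (f : Fin m → Subset _) → v ∈ ⋃ (List.tabulate f) → ∃ λ h → v ∈ f h
  go {zero}  f v∈ = contradiction v∈ ∉⊥
  go {suc m} f v∈ with x∈p∪q⁻ (f zero) _ v∈
  ... | inj₁ v∈0 = zero , v∈0
  ... | inj₂ v∈s with h , v∈h ← go (f ∘ suc) v∈s = suc h , v∈h

module Spine {n : ℕ} {G : Graph n} (R : Rooted G (λ _ → true)) (ℓ : ℕ)
             (spine : ∀ i → suc i ≤ ℓ → Rooted.par R (suc i) ≡ i) where
  open RootedProperties R

  spine-≼ : ∀ {i} j → i ≤ j → j ≤ ℓ → i ≼ j
  spine-≼ zero    z≤n _ = here
  spine-≼ (suc j) i≤j j≤ℓ with m≤n⇒m<n∨m≡n i≤j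
  ... | inj₂ refl = here
  ... | inj₁ i<j  = down (subst (_ ≼_) (≡-sym (spine j j≤ℓ)) (spine-≼ j (≤-pred i<j) (<⇒≤ j≤ℓ)))

  -- Spine nodes that are not the top of a vertex of Z carry no new vertex of Z;
  -- they are bypassed by attaching their children to the nearest spine node
  -- above them that is such a top.
  module Restrict (Z : VSet n) where

    Hit : ℕ → Set
    Hit h = ∃ λ v → Z v ≡ true × top v ≡ h

    hit? : ∀ h → Dec (Hit h)
    hit? h = any? λ v → (Z v Data.Bool.≟ true) ×-dec (top v ≟ h)

    -- The root is the default when no node up to `h` is hit, so that every bypassed node has a
    -- replacement.
    lastHit : ℕ → ℕ
    lastHit zero    = 0
    lastHit (suc h) = if ⌊ hit? (suc h) ⌋ then suc h else lastHit h

    lastHit-hit : ∀ h → Hit (suc h) → lastHit (suc h) ≡ suc h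
    lastHit-hit h hit rewrite ⌊⌋-true (hit? (suc h)) hit = refl

    lastHit-miss : ∀ h → ¬ Hit (suc h) → lastHit (suc h) ≡ lastHit h
    lastHit-miss h miss rewrite ⌊⌋-false (hit? (suc h)) miss = refl

    lastHit-≤ : ∀ h → lastHit h ≤ h
    lastHit-≤ zero    = z≤n
    lastHit-≤ (suc h) with hit? (suc h)
    ... | yes _ = ≤-refl
    ... | no  _ = ≤-trans (lastHit-≤ h) (n≤1+n h)

    lastHit-max : ∀ h {v} → Z v ≡ true → top v ≤ h → top v ≤ lastHit h
    lastHit-max zero    _   t≤ = t≤
    lastHit-max (suc h) {v} v∈Z t≤ with hit? (suc h)
    ... | yes _    = t≤
    ... | no  miss with m≤n⇒m<n∨m≡n t≤
    ...   | inj₁ t<h = lastHit-max h v∈Z (≤-pred t<h)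
    ...   | inj₂ t≡h = contradiction (v , v∈Z , t≡h) miss

    bypass : ℕ → ℕ
    bypass j = if ⌊ j ≤? ℓ ⌋ then lastHit j else j

    bypass-≤ : ∀ j → bypass j ≤ j
    bypass-≤ j with j ≤? ℓ
    ... | yes _ = lastHit-≤ j
    ... | no  _ = ≤-refl

    bypass-spine : ∀ {j} → j ≤ ℓ → bypass j ≡ lastHit j
    bypass-spine {j} j≤ℓ rewrite ⌊⌋-true (j ≤? ℓ) j≤ℓ = refl

    -- The top of a vertex of `Z` in a spine bag `j` is itself on the spine and hit, so it lies at
    -- or above `lastHit j`; the interval property then puts the vertex into that bag.
    bypass-X : ∀ j {v} → Z v ≡ true → X j v ≡ true → X (bypass j) v ≡ true
    bypass-X j {v} v∈Z v∈j with j ≤? ℓ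
    ... | no  _   = v∈j
    ... | yes j≤ℓ = X-interval refl v∈j (spine-≼ j (lastHit-≤ j) j≤ℓ)
      (spine-≼ (lastHit j) (lastHit-max j v∈Z (≼⇒≤ (top≼ v∈j))) (≤-trans (lastHit-≤ j) j≤ℓ))

    -- All nodes are kept: a spine node other than the root that is not hit stays in the tree as a
    -- leaf.
    restricted : Rooted G Z
    restricted = record
      { size   = size
      ; 0<size = 0<size
      ; par    = bypass ∘ par
      ; par≤   = λ i → ≤-trans (bypass-≤ (par (suc i))) (par≤ i)
      ; X      = λ i v → X i v ∧ Z v
      ; X<size = X<size ∘ proj₁ ∘ ∧-true
      ; X⊆S    = proj₂ ∘ ∧-true
      ; top    = top
      ; top∈   = λ v∈Z → ∧-true⁺ (top∈ refl) v∈Z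
      ; X-zero = X-zero ∘ proj₁ ∘ ∧-true
      ; X-suc  = X-suc′
      ; common = λ u∈Z v∈Z uv → let i , u∈ , v∈ = common refl refl uv in
                   i , ∧-true⁺ u∈ u∈Z , ∧-true⁺ v∈ v∈Z
      }
      where
      X-suc′ : ∀ {i v} → (X (suc i) v ∧ Z v) ≡ true →
               top v ≡ suc i ⊎ (X (bypass (par (suc i))) v ∧ Z v) ≡ true
      X-suc′ v∈ with v∈i , v∈Z ← ∧-true v∈ with X-suc v∈i
      ... | inj₁ eq  = inj₁ eq
      ... | inj₂ v∈p = inj₂ (∧-true⁺ (bypass-X _ v∈Z v∈p) v∈Z)

    module R′ = RootedProperties restricted

    D′ : TreeDec G (tabulate Z)
    D′ = R′.treeDec

    Covers : ℕ → TPath (T D′) → Set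
    Covers h Q = ∀ v → Z v ≡ true → top v ≤ h → ∃ λ i → toℕ (node Q i) ≡ top v

    -- Paths grow at their front, so they run from the lowest hit node upwards and the nonredundant
    -- end is the last node. Inclusion of a bag in the next one fails at a vertex whose top is the
    -- lower node, since no bag of smaller index contains that vertex.
    HitPath : ℕ → Set
    HitPath h = Σ (TPath (T D′)) λ Q → toℕ (first Q) ≡ lastHit h × (∀ i → toℕ (node Q i) ≤ h) ×
                  NonredEnd D′ Q × Covers h Q

    hit-bag : ∀ {h} (i : Fin size) → toℕ i ≡ h → (w : Hit h) → proj₁ w ∈ bag D′ i
    hit-bag i refl (w , w∈Z , t≡i) =
      ∈-tabulate⁺ (∧-true⁺ (subst (λ j → X j w ≡ true) t≡i (top∈ refl)) w∈Z)

    single-hit : ∀ h → Hit h → (∀ v → Z v ≡ true → h ≤ top v) → lastHit h ≡ h → HitPath h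
    single-hit h w@(w₀ , w∈Z , t≡h) low last≡ =
      single i , trans i≡h (≡-sym last≡) , (λ _ → ≤-reflexive i≡h) ,
      ((λ empty → ∉⊥ (subst (w₀ ∈_) empty (hit-bag i i≡h w))) , λ ()) ,
      λ v v∈Z t≤h → zero , trans i≡h (≤-antisym (low v v∈Z) t≤h)
      where
      h<size : h < size
      h<size = subst (_< size) t≡h (X<size (top∈ refl))
      i : Fin size
      i = fromℕ< h<size
      i≡h : toℕ i ≡ h
      i≡h = toℕ-fromℕ< h<size

    hitStep : ∀ h → suc h ≤ ℓ → Dec (Hit (suc h)) → (∀ v → Z v ≡ true → h < top v) ⊎ HitPath h →
              (∀ v → Z v ≡ true → suc h < top v) ⊎ HitPath (suc h)
    hitStep h h<ℓ (no miss) (inj₁ none) = inj₁ λ v v∈Z → ≤∧≢⇒< (none v v∈Z) λ eq → miss (v , v∈Z , ≡-sym eq)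
    hitStep h h<ℓ (yes hit) (inj₁ none) = inj₂ (single-hit (suc h) hit none (lastHit-hit h hit))
    hitStep h h<ℓ (no miss) (inj₂ (Q , fst , bd , nr , cov)) =
      inj₂ (Q , trans fst (≡-sym (lastHit-miss h miss)) , (λ i → ≤-trans (bd i) (n≤1+n h)) , nr , cov′)
      where
      cov′ : Covers (suc h) Q
      cov′ v v∈Z t≤ with m≤n⇒m<n∨m≡n t≤
      ... | inj₁ t<  = cov v v∈Z (≤-pred t<)
      ... | inj₂ t≡h = contradiction (v , v∈Z , t≡h) miss
    hitStep h h<ℓ (yes hit@(w , w∈Z , t≡h)) (inj₂ (Q , fst , bd , (end , nr) , cov)) =
      inj₂ (Q′ , trans i≡h (≡-sym (lastHit-hit h hit)) , bd′ , (end , nr′) , cov′)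
      where
      h<size : suc h < size
      h<size = subst (_< size) t≡h (X<size (top∈ refl))
      i : Fin size
      i = fromℕ< h<size
      i≡h : toℕ i ≡ suc h
      i≡h = toℕ-fromℕ< h<size
      Q′ : TPath (T D′)
      Q′ = cons i Q
        (inj₂ (h , i≡h , trans fst (≡-sym (trans (cong bypass (spine h h<ℓ)) (bypass-spine (<⇒≤ h<ℓ))))))
        (λ j eq → <⇒≱ (s≤s (bd j)) (≤-reflexive (trans (≡-sym i≡h) (cong toℕ (≡-sym eq)))))
      bd′ : ∀ j → toℕ (node Q′ j) ≤ suc h
      bd′ zero    = ≤-reflexive i≡h
      bd′ (suc j) = ≤-trans (bd j) (n≤1+n h)
      nr′ : ∀ j → ¬ (bag D′ (node Q′ (inject₁ j)) ⊆ bag D′ (node Q′ (suc j)))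
      nr′ (suc j) = nr j
      nr′ zero i⊆ = <⇒≱ (s≤s (bd zero)) (subst (_≤ toℕ (first Q)) t≡h (≼⇒≤ (top≼
        (proj₁ (∧-true (∈-tabulate⁻ (i⊆ (hit-bag i i≡h hit))))))))
      cov′ : Covers (suc h) Q′
      cov′ v v∈Z t≤ with m≤n⇒m<n∨m≡n t≤
      ... | inj₂ t≡ = zero , trans i≡h (≡-sym t≡)
      ... | inj₁ t< with j , eq ← cov v v∈Z (≤-pred t<) = suc j , eq

    hitPath : ∀ h → h ≤ ℓ → (∀ v → Z v ≡ true → h < top v) ⊎ HitPath h
    hitPath zero _ with hit? 0
    ... | yes hit = inj₂ (single-hit 0 hit (λ _ _ → z≤n) refl)
    ... | no miss = inj₁ λ v v∈Z → n≢0⇒n>0 λ t≡0 → miss (v , v∈Z , t≡0)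
    hitPath (suc h) h<ℓ = hitStep h h<ℓ (hit? (suc h)) (hitPath h (<⇒≤ h<ℓ))

    restricted-path : (∃ λ v → Z v ≡ true × top v ≤ ℓ) →
      Σ (TPath (T D′)) λ Q → Nonredundant D′ Q × count (λ v → Z v ∧ (top v ≤ᵇ ℓ)) ≤ coverSize D′ Q
    restricted-path (w , w∈Z , t≤) with hitPath ℓ ≤-refl
    ... | inj₁ none = contradiction t≤ (<⇒≱ (none w w∈Z))
    ... | inj₂ (Q , _ , _ , nr , cov) =
      Q , inj₂ nr , ≤-trans (count-mono λ v v∈ → []=⇒lookup (covered v v∈)) (≤-reflexive (≡-sym (∣∣-lookup union)))
      where
      union : Subset n
      union = ⋃ (map (λ h → bag D′ (node Q h)) (allFin (suc (len Q))))
      covered : ∀ v → (Z v ∧ (top v ≤ᵇ ℓ)) ≡ true → v ∈ union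
      covered v v∈ with v∈Z , t≤ ← ∧-true v∈
        with j , eq ← cov v v∈Z (≤ᵇ⇒≤ _ _ (Equivalence.from T-≡ t≤)) =
        ∈-⋃⁺ (λ h → bag D′ (node Q h)) j (hit-bag (node Q j) eq (v , v∈Z , refl))

-- Splitting off a prescribed number of vertices

greatest : ∀ {Q : ℕ → Set} → (∀ i → Dec (Q i)) → ∀ b → (∀ i → b ≤ i → ¬ Q i) → Q 0 →
           ∃ λ i → Q i × (∀ j → i < j → ¬ Q j)
greatest Q? zero    none q = contradiction q (none 0 z≤n)
greatest Q? (suc b) none q with Q? b
... | yes qb = b , qb , none
... | no ¬qb = greatest Q? b (λ i b≤i → case m≤n⇒m<n∨m≡n b≤i of
                 λ { (inj₁ b<i) → none i b<i ; (inj₂ refl) → ¬qb }) q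

module Halving {n : ℕ} {G : Graph n} (R : Rooted G (λ _ → true)) where
  open RootedProperties R

  child-towards : ∀ {i j} → i ≼ j → i ≢ j → ∃ λ c → par (suc c) ≡ i × suc c ≼ j
  child-towards here i≢i = contradiction refl i≢i
  child-towards {i} (down {j} i≼p) _ with i ≟ par (suc j)
  ... | yes i≡p = j , ≡-sym i≡p , here
  ... | no i≢p with c , eq , c≼p ← child-towards i≼p i≢p = c , eq , down c≼p

  child-unique : ∀ {i j c c′} → par (suc c) ≡ i → suc c ≼ j → par (suc c′) ≡ i → suc c′ ≼ j → c ≡ c′
  child-unique {i} {j} {c} {c′} pc c≼j pc′ c′≼j with c ≟ c′
  ... | yes eq = eq
  ... | no c≢c′ with ≼-linear c≼j c′≼j
  ...   | inj₁ c≼c′ = contradiction (subst (suc c ≤_) (trans pc′ (≡-sym pc)) (≼⇒≤ (≼-par c≼c′ λ { refl → c≢c′ refl })))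
                        (<⇒≱ (s≤s (par≤ c)))
  ...   | inj₂ c′≼c = contradiction (subst (suc c′ ≤_) (trans pc (≡-sym pc′)) (≼⇒≤ (≼-par c′≼c λ { refl → c≢c′ refl })))
                        (<⇒≱ (s≤s (par≤ c′)))

  -- If `u` lies in the bag at the top of `v`, that top is below the top of `u`. Otherwise `v` lies
  -- in the bag at the top of `u`; on the climb from there it cannot pass from `suc c` to the
  -- parent, so its top has been met by then.
  edge-same-child : ∀ {u v c} → adj G u v ≡ true → X (par (suc c)) v ≡ false →
                    suc c ≼ top u → suc c ≼ top v
  edge-same-child {u} {v} uv v∉ c≼u with edge-top refl refl uv
  ... | inj₁ u∈ = ≼-trans c≼u (top≼ u∈)
  ... | inj₂ v∈ with X-between v∈ c≼u
  ...   | inj₂ c≼v = c≼v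
  ...   | inj₁ v∈c with X-suc v∈c
  ...     | inj₁ eq  = subst (_ ≼_) (≡-sym eq) here
  ...     | inj₂ v∈p = contradiction v∉ (true≢false v∈p)

  top<size : ∀ v → top v < size
  top<size v = X<size (top∈ {v} refl)

  Below : VSet n → ℕ → VSet n
  Below U i v = U v ∧ ⌊ i ≼? top v ⌋

  -- Removing the bag of i leaves the vertices below i grouped by the child of i
  -- above their top; the vertices whose top is i form singleton groups.
  module Groups (i : ℕ) where

    -- The codes cannot collide: 0 is not a child, and node indices are below `size`.
    data Group (v : Fin n) : ℕ → Set where
      outside : ¬ i ≼ top v → Group v 0
      at      : top v ≡ i → Group v (size + toℕ v)
      below   : ∀ {c} → par (suc c) ≡ i → suc c ≼ top v → Group v (suc c)

    classify : ∀ v → ∃ (Group v)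
    classify v with i ≼? top v
    ... | no ⋠  = 0 , outside ⋠
    ... | yes i≼t with i ≟ top v
    ...   | yes eq = _ , at (≡-sym eq)
    ...   | no i≢t with c , pc , c≼t ← child-towards i≼t i≢t = suc c , below pc c≼t

    γ : Fin n → ℕ
    γ v = proj₁ (classify v)

    γ-group : ∀ v → Group v (γ v)
    γ-group v = proj₂ (classify v)

    at-bag : ∀ {v} → top v ≡ i → ¬ X i v ≡ false
    at-bag {v} t≡i = true≢false (subst (λ j → X j v ≡ true) t≡i (top∈ refl))

    below-≼ : ∀ {c j} → par (suc c) ≡ i → suc c ≼ j → i ≼ j
    below-≼ pc c≼j = ≼-trans (down (subst (i ≼_) (≡-sym pc) here)) c≼j

    edge-group : ∀ {u v a b} → adj G u v ≡ true → X i u ≡ false → X i v ≡ false →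
                 Group u a → Group v b → a ≡ b
    edge-group uv u∉ v∉ (at t≡i)       _              = contradiction u∉ (at-bag t≡i)
    edge-group uv u∉ v∉ _              (at t≡i)       = contradiction v∉ (at-bag t≡i)
    edge-group uv u∉ v∉ (outside _)    (outside _)    = refl
    edge-group {u} {v} uv u∉ v∉ (outside ⋠) (below pc c≼v) = contradiction
      (below-≼ pc (edge-same-child (trans (Graph.sym G v u) uv) (subst (λ j → X j u ≡ false) (≡-sym pc) u∉) c≼v)) ⋠
    edge-group {u} {v} uv u∉ v∉ (below pc c≼u) (outside ⋠) = contradiction
      (below-≼ pc (edge-same-child uv (subst (λ j → X j v ≡ false) (≡-sym pc) v∉) c≼u)) ⋠
    edge-group {u} {v} uv u∉ v∉ (below pc c≼u) (below pc′ c′≼v) =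
      cong suc (child-unique pc (edge-same-child uv (subst (λ j → X j v ≡ false) (≡-sym pc) v∉) c≼u) pc′ c′≼v)

    below<size : ∀ {c} v → suc c ≼ top v → suc c < size
    below<size v c≼t = ≤-<-trans (≼⇒≤ c≼t) (top<size v)

    -- The group of a child consists of vertices below that child, whose index exceeds `i`; the
    -- remaining groups are singletons, and `1 ≤ L`.
    group-≤ : ∀ {U L} → 1 ≤ L → (∀ j → i < j → ¬ L ≤ count (Below U j)) →
              ∀ g → count (λ v → U v ∧ ⌊ γ v ≟ suc g ⌋) ≤ L
    group-≤ {U} {L} 1≤L small g with 1 ≤? count (λ v → U v ∧ ⌊ γ v ≟ suc g ⌋)
    ... | no none = ≤-trans (≤-pred (≰⇒> none)) z≤n
    ... | yes some with w , w∈ ← count-witness some =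
      by-witness (subst (Group w) (⌊⌋-true⁻ (γ w ≟ suc g) (proj₂ (∧-true w∈))) (γ-group w)) refl
      where
      by-witness : ∀ {x} → Group w x → x ≡ suc g → count (λ v → U v ∧ ⌊ γ v ≟ suc g ⌋) ≤ L
      by-witness (below {c} pc c≼w) refl = ≤-trans (count-mono sub)
        (<⇒≤ (≰⇒> (small (suc c) (s≤s (subst (_≤ c) pc (par≤ c))))))
        where
        in-child : ∀ {v x} → Group v x → x ≡ suc c → suc c ≼ top v
        in-child (below _ c≼v) refl = c≼v
        in-child {v} (at _) eq = contradiction (≤-trans (m≤m+n size (toℕ v)) (≤-reflexive eq)) (<⇒≱ (below<size w c≼w))
        sub : ∀ v → (U v ∧ ⌊ γ v ≟ suc c ⌋) ≡ true → Below U (suc c) v ≡ true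
        sub v v∈ with v∈U , eq ← ∧-true v∈ =
          ∧-true⁺ v∈U (⌊⌋-true (suc c ≼? top v) (in-child (γ-group v) (⌊⌋-true⁻ (γ v ≟ suc c) eq)))
      by-witness (at _) eq = ≤-trans (count-single λ u v u∈ v∈ → toℕ-injective
        (+-cancelˡ-≡ size _ _ (trans (only u u∈) (≡-sym (only v v∈))))) 1≤L
        where
        alone : ∀ {v x} → Group v x → x ≡ suc g → size + toℕ v ≡ suc g
        alone (at _) eq′ = eq′
        alone {v} (below pc c≼v) eq′ = contradiction (≤-trans (m≤m+n size (toℕ w)) (≤-reflexive (trans eq (≡-sym eq′))))
                                  (<⇒≱ (below<size v c≼v))
        only : ∀ v → (U v ∧ ⌊ γ v ≟ suc g ⌋) ≡ true → size + toℕ v ≡ suc g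
        only v v∈ = alone (γ-group v) (⌊⌋-true⁻ (γ v ≟ suc g) (proj₂ (∧-true v∈)))

    Upto : VSet n → ℕ → VSet n
    Upto U g v = U v ∧ ((0 <ᵇ γ v) ∧ (γ v <ᵇ suc g))

    Upto-suc : ∀ U g → count (Upto U (suc g)) ≡ count (Upto U g) + count (λ v → U v ∧ ⌊ γ v ≟ suc g ⌋)
    Upto-suc U g = count-+ (λ v → eq (U v) (γ v))
      where
      eq : ∀ a x → b2n (a ∧ ((0 <ᵇ x) ∧ (x <ᵇ suc (suc g)))) ≡
                   b2n (a ∧ ((0 <ᵇ x) ∧ (x <ᵇ suc g))) + b2n (a ∧ ⌊ x ≟ suc g ⌋)
      eq false x = refl
      eq true zero rewrite ⌊⌋-false (0 ≟ suc g) (λ ()) = refl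
      eq true (suc x) with <-cmp x g
      ... | tri< x<g x≢g _ rewrite <⇒<ᵇ-true x<g | <⇒<ᵇ-true (<-trans x<g (n<1+n g))
                                 | ⌊⌋-false (suc x ≟ suc g) (λ e → x≢g (cong pred e)) = refl
      ... | tri≈ _ refl _ rewrite <⇒<ᵇ-true (n<1+n x) | ≥⇒<ᵇ-false (≤-refl {x})
                                 | ⌊⌋-true (suc x ≟ suc x) refl = refl
      ... | tri> _ x≢g g<x rewrite ≥⇒<ᵇ-false g<x | ≥⇒<ᵇ-false (<⇒≤ g<x)
                                 | ⌊⌋-false (suc x ≟ suc g) (λ e → x≢g (cong pred e)) = refl

    Below⊆Upto : ∀ U v → Below U i v ≡ true → Upto U (size + n) v ≡ true
    Below⊆Upto U v v∈ with v∈U , i≼ ← ∧-true v∈ = ∧-true⁺ v∈U (range (γ-group v) (⌊⌋-true⁻ (i ≼? top v) i≼))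
      where
      range : ∀ {x} → Group v x → i ≼ top v → ((0 <ᵇ x) ∧ (x <ᵇ suc (size + n))) ≡ true
      range (outside ⋠)    i≼t = contradiction i≼t ⋠
      range (at _)         _   = ∧-true⁺ (<⇒<ᵇ-true (≤-trans 0<size (m≤m+n size _)))
                                   (<⇒<ᵇ-true (s≤s (+-monoʳ-≤ size (<⇒≤ (toℕ<n v)))))
      range (below _ c≼t)  _   = <⇒<ᵇ-true (s≤s (≤-trans (<⇒≤ (below<size v c≼t)) (m≤m+n size n)))

    Upto-0 : ∀ U → count (Upto U 0) ≡ 0
    Upto-0 U = count-none (Upto U 0) λ v → none (U v) (γ v)
      where
      none : ∀ a x → (a ∧ ((0 <ᵇ x) ∧ (x <ᵇ 1))) ≡ false
      none false x       = refl
      none true  zero    = refl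
      none true  (suc x) = refl

  -- Only edges inside `U` are considered; those leaving `U` are left to the bags that cut out `U`.
  Cut : VSet n → VSet n → VSet n → Set
  Cut U Q A = ∀ u v → adj G u v ≡ true → U u ≡ true → U v ≡ true → Q u ≡ false → Q v ≡ false → A u ≡ A v

  -- Let `i` be the greatest index with at least `L` vertices of `U` at or below it, so that each
  -- group below `i` has at most `L` vertices. Groups are collected until they hold at least
  -- `L / 2`. If the last group alone holds that much, it is taken by itself; otherwise less than
  -- `L / 2` was there before and less than `L / 2` was added, so the whole collection has at most
  -- `L`.
  halve : ∀ U L → 1 ≤ L → L ≤ count U →
          ∃ λ i → Σ (VSet n) λ A → (∀ v → A v ≡ true → U v ≡ true) × count A ≤ L × L ≤ 2 * count A × Cut U (X i) A
  halve U L 1≤L L≤U with greatest (λ i → L ≤? count (Below U i)) size none root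
    where
    none : ∀ i → size ≤ i → ¬ L ≤ count (Below U i)
    none i size≤i L≤ = <⇒≱ 1≤L (≤-trans L≤ (≤-reflexive (count-none (Below U i) empty)))
      where
      empty : ∀ v → Below U i v ≡ false
      empty v = ¬-not λ v∈ → <⇒≱ (top<size v)
        (≤-trans size≤i (≼⇒≤ (⌊⌋-true⁻ (i ≼? top v) (proj₂ (∧-true {U v} v∈)))))
    root : L ≤ count (Below U 0)
    root = ≤-trans L≤U (count-mono λ v v∈ → ∧-true⁺ v∈ (⌊⌋-true (0 ≼? top v) (0≼ (top v))))
  ... | i , big , small with least (λ g → L ≤? 2 * count (Groups.Upto i U g)) (size + n)
          (≤-trans big (≤-trans (count-mono (Groups.Below⊆Upto i U)) (m≤m+n _ _)))
  ...   | zero  , L≤ , _ , _ =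
    contradiction (≤-trans L≤ (≤-reflexive (cong (2 *_) (Groups.Upto-0 i U)))) (<⇒≱ 1≤L)
  ...   | suc g , L≤ , _ , low = i , choose (L ≤? 2 * count piece)
    where
    open Groups i
    piece : VSet n
    piece v = U v ∧ ⌊ γ v ≟ suc g ⌋
    by-γ : (Q : ℕ → Bool) → Cut U (X i) (λ v → U v ∧ Q (γ v))
    by-γ Q u v uv u∈ v∈ u∉ v∉ =
      cong₂ (λ a x → a ∧ Q x) (trans u∈ (≡-sym v∈)) (edge-group uv u∉ v∉ (γ-group u) (γ-group v))
    choose : Dec (L ≤ 2 * count piece) →
      Σ (VSet n) λ A → (∀ v → A v ≡ true → U v ≡ true) × count A ≤ L × L ≤ 2 * count A × Cut U (X i) A
    choose (yes L≤piece) = piece , (λ v → proj₁ ∘ ∧-true) , group-≤ 1≤L small g , L≤piece , by-γ (λ x → ⌊ x ≟ suc g ⌋)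
    choose (no piece<) = Upto U (suc g) , (λ v → proj₁ ∘ ∧-true) , *-cancelˡ-≤ 2 both , L≤ ,
                         by-γ (λ x → (0 <ᵇ x) ∧ (x <ᵇ suc (suc g)))
      where
      open ≤-Reasoning
      both : 2 * count (Upto U (suc g)) ≤ 2 * L
      both = begin
        2 * count (Upto U (suc g))               ≡⟨ cong (2 *_) (Upto-suc U g) ⟩
        2 * (count (Upto U g) + count piece)     ≡⟨ *-distribˡ-+ 2 (count (Upto U g)) (count piece) ⟩
        2 * count (Upto U g) + 2 * count piece   ≤⟨ +-mono-≤ (<⇒≤ (≰⇒> (low g ≤-refl))) (<⇒≤ (≰⇒> piece<)) ⟩
        L + L                                    ≡⟨ cong (L +_) (≡-sym (+-identityʳ L)) ⟩
        2 * L                                    ∎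

  ∅ : VSet n
  ∅ _ = false

  count-∅ : count ∅ ≡ 0
  count-∅ = count-none ∅ λ _ → refl

  opaque
    -- Each round takes at least half of what is still missing and spends one bag, so `j` rounds
    -- bring the deficit from `L` down to the tolerance `d`. The recursion works in the part of `U`
    -- not yet taken, already separated from the part taken by the first bag.
    approximate : ∀ {t} → (∀ i → count (X i) ≤ t) → ∀ d j U L → L ≤ 2 ^ j * d → L ≤ count U →
      Σ (VSet n) λ A → Σ (VSet n) λ Q → (∀ v → A v ≡ true → U v ≡ true) × count A ≤ L × L ≤ count A + d ×
        count Q ≤ j * t × Cut U Q A
    approximate width d zero U L L≤ _ =
      ∅ , ∅ , (λ v ()) , ≤-trans (≤-reflexive count-∅) z≤n ,
      ≤-trans (subst (L ≤_) (+-identityʳ d) L≤) (m≤n+m d _) , ≤-reflexive count-∅ , λ u v _ _ _ _ _ → refl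
    approximate width d (suc j) U zero L≤ _ =
      ∅ , ∅ , (λ v ()) , ≤-reflexive count-∅ ,
      z≤n , ≤-trans (≤-reflexive count-∅) z≤n , λ u v _ _ _ _ _ → refl
    approximate {t} width d (suc j) U L@(suc _) L≤ L≤U with halve U L (s≤s z≤n) L≤U
    ... | i , A₁ , A₁⊆U , A₁≤L , L≤2A₁ , cut₁
      with approximate width d j (λ v → U v ∧ not (A₁ v)) (L ∸ count A₁) rest≤ fits
      where
      open ≤-Reasoning
      rest≤ : L ∸ count A₁ ≤ 2 ^ j * d
      rest≤ = *-cancelˡ-≤ 2 (begin
        2 * (L ∸ count A₁)     ≡⟨ *-distribˡ-∸ 2 L (count A₁) ⟩
        2 * L ∸ 2 * count A₁   ≤⟨ ∸-monoʳ-≤ (2 * L) L≤2A₁ ⟩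
        2 * L ∸ L              ≡⟨ trans (m+n∸m≡n L (L + 0)) (+-identityʳ L) ⟩
        L                      ≤⟨ L≤ ⟩
        2 * 2 ^ j * d          ≡⟨ *-assoc 2 (2 ^ j) d ⟩
        2 * (2 ^ j * d)        ∎)
      fits : L ∸ count A₁ ≤ count (λ v → U v ∧ not (A₁ v))
      fits = m≤n+o⇒m∸n≤o L (count A₁) (≤-trans L≤U (≤-reflexive (count-∖ U A₁ A₁⊆U)))
    ... | A₂ , Q , A₂⊆ , A₂≤ , ≤A₂ , Q≤ , cut₂ =
      (λ v → A₁ v ∨ A₂ v) , (λ v → X i v ∨ Q v) , sub ,
      ≤-trans (≤-reflexive size-A) (≤-trans (+-monoʳ-≤ (count A₁) A₂≤) (≤-reflexive (m+[n∸m]≡n A₁≤L))) ,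
      enough , ≤-trans (count-∨-≤ (X i) Q) (+-mono-≤ (width i) Q≤) , cut
      where
      open ≤-Reasoning
      disjoint : ∀ v → A₁ v ≡ true → A₂ v ≡ false
      disjoint v v∈₁ = ¬-not λ v∈₂ → true≢false (proj₂ (∧-true {U v} (A₂⊆ v v∈₂))) (cong not v∈₁)
      size-A : count (λ v → A₁ v ∨ A₂ v) ≡ count A₁ + count A₂
      size-A = count-∨ A₁ A₂ disjoint
      sub : ∀ v → (A₁ v ∨ A₂ v) ≡ true → U v ≡ true
      sub v v∈ with A₁ v in eq
      ... | true  = A₁⊆U v eq
      ... | false = proj₁ (∧-true (A₂⊆ v v∈))
      enough : L ≤ count (λ v → A₁ v ∨ A₂ v) + d
      enough = begin
        L                              ≡⟨ m+[n∸m]≡n A₁≤L ⟨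
        count A₁ + (L ∸ count A₁)      ≤⟨ +-monoʳ-≤ (count A₁) ≤A₂ ⟩
        count A₁ + (count A₂ + d)      ≡⟨ +-assoc (count A₁) _ d ⟨
        count A₁ + count A₂ + d        ≡⟨ cong (_+ d) (≡-sym size-A) ⟩
        count (λ v → A₁ v ∨ A₂ v) + d  ∎
      cut : Cut U (λ v → X i v ∨ Q v) (λ v → A₁ v ∨ A₂ v)
      cut u v uv u∈ v∈ u∉ v∉ with cut₁ u v uv u∈ v∈ (proj₁ (∨-false u∉)) (proj₁ (∨-false v∉))
      ... | same with A₁ u in u₁ | A₁ v in v₁ | same
      ...   | true  | true  | refl = refl
      ...   | false | false | refl = cut₂ u v uv (∧-true⁺ u∈ (cong not u₁)) (∧-true⁺ v∈ (cong not v₁))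
                                       (proj₂ (∨-false {X i u} u∉)) (proj₂ (∨-false {X i v} v∉))

-- Arcs on a circle

window : (ℕ → Bool) → ℕ → ℕ → ℕ
window ρ a zero    = 0
window ρ a (suc l) = b2n (ρ a) + window ρ (suc a) l

window-+ : ∀ ρ a l l′ → window ρ a (l + l′) ≡ window ρ a l + window ρ (a + l) l′
window-+ ρ a zero    l′ = cong (λ x → window ρ x l′) (≡-sym (+-identityʳ a))
window-+ ρ a (suc l) l′ = begin
  b2n (ρ a) + window ρ (suc a) (l + l′)                       ≡⟨ cong (b2n (ρ a) +_) (window-+ ρ (suc a) l l′) ⟩
  b2n (ρ a) + (window ρ (suc a) l + window ρ (suc a + l) l′)  ≡⟨ +-assoc (b2n (ρ a)) _ _ ⟨
  window ρ a (suc l) + window ρ (suc a + l) l′                ≡⟨ cong (λ x → window ρ a (suc l) + window ρ x l′) (+-suc a l) ⟨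
  window ρ a (suc l) + window ρ (a + suc l) l′                ∎
  where open ≡-Reasoning

window-cong : ∀ {ρ σ} a b l → (∀ i → i < l → ρ (a + i) ≡ σ (b + i)) → window ρ a l ≡ window σ b l
window-cong         a b zero    eq = refl
window-cong {ρ} {σ} a b (suc l) eq = cong₂ _+_
  (cong b2n (trans (cong ρ (≡-sym (+-identityʳ a))) (trans (eq 0 (s≤s z≤n)) (cong σ (+-identityʳ b)))))
  (window-cong (suc a) (suc b) l λ i i<l →
    trans (cong ρ (≡-sym (+-suc a i))) (trans (eq (suc i) (s≤s i<l)) (cong σ (+-suc b i))))

window-none : ∀ ρ a l → (∀ i → i < l → ρ (a + i) ≡ false) → window ρ a l ≡ 0
window-none ρ a l none = trans (window-cong {σ = λ _ → false} a a l none) (zeros a l)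
  where
  zeros : ∀ a l → window (λ _ → false) a l ≡ 0
  zeros a zero    = refl
  zeros a (suc l) = zeros (suc a) l

window-witness : ∀ ρ a l → 1 ≤ window ρ a l → ∃ λ i → i < l × ρ (a + i) ≡ true
window-witness ρ a (suc l) 1≤ with ρ a in eq
... | true  = 0 , s≤s z≤n , trans (cong ρ (+-identityʳ a)) eq
... | false with i , i<l , ρi ← window-witness ρ (suc a) l 1≤ = suc i , s≤s i<l , trans (cong ρ (+-suc a i)) ρi

window-≤ : ∀ ρ a l → window ρ a l ≤ l
window-≤ ρ a zero    = z≤n
window-≤ ρ a (suc l) = +-mono-≤ (b2n≤1 (ρ a)) (window-≤ ρ (suc a) l)

Periodic : ℕ → (ℕ → Bool) → Set
Periodic n ρ = ∀ p → ρ (p + n) ≡ ρ p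

window-periodic : ∀ {n ρ} → Periodic n ρ → ∀ a → window ρ a n ≡ window ρ 0 n
window-periodic         per zero    = refl
window-periodic {n} {ρ} per (suc a) = trans (+-cancelˡ-≡ (b2n (ρ a)) _ _ shift) (window-periodic per a)
  where
  open ≡-Reasoning
  shift : b2n (ρ a) + window ρ (suc a) n ≡ b2n (ρ a) + window ρ a n
  shift = begin
    window ρ a (suc n)                   ≡⟨ cong (window ρ a) (+-comm 1 n) ⟩
    window ρ a (n + 1)                   ≡⟨ window-+ ρ a n 1 ⟩
    window ρ a n + (b2n (ρ (a + n)) + 0) ≡⟨ cong (window ρ a n +_) (trans (+-identityʳ _) (cong b2n (per a))) ⟩
    window ρ a n + b2n (ρ a)             ≡⟨ +-comm (window ρ a n) _ ⟩
    b2n (ρ a) + window ρ a n             ∎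

+-swapʳ : ∀ a b c → a + b + c ≡ a + c + b
+-swapʳ = solve-∀

module Circle (n : ℕ) (0<n : 0 < n) (r : ℕ) (1≤r : 1 ≤ r) where

  -- The last condition is density at least `2 * r / n` with denominators cleared. It is trivial for
  -- `L = 0`, the case of a point of both kinds, which later gives the exact split.
  Run : (A M : ℕ → Bool) → Set
  Run A M = ∃ λ s → ∃ λ L → A s ≡ true × (∀ i → i < L → M (s + i) ≡ false) × M (s + L) ≡ true ×
              2 * r * L ≤ n * window A s L

  record Cyclic (A : ℕ → Bool) : Set where
    field
      periodic : Periodic n A
      total    : window A 0 n ≡ r
  open Cyclic

  next : ∀ {M} → Cyclic M → ∀ s → ∃ λ L → M (s + L) ≡ true × (∀ i → i < L → M (s + i) ≡ false)
  next {M} cM s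
    with i , _ , Mi ← window-witness M s n (subst (1 ≤_) (≡-sym (trans (window-periodic (periodic cM) s) (total cM))) 1≤r)
    with L , ML , _ , low ← least (λ i → M (s + i) Data.Bool.≟ true) i Mi = L , ML , λ j j<L → ¬-not (low j j<L)

  points : (A M : ℕ → Bool) → ℕ → ℕ
  points A M s = window A 0 s + window M 0 s

  -- Every full turn contributes exactly `2 * r` points, so the number of points up to `s` lags
  -- behind its mean by at most the points of one turn.
  points-bound : ∀ {A M} → Cyclic A → Cyclic M → ∀ s → 2 * r * s ≤ n * points A M s + 2 * r * n
  points-bound {A} {M} cA cM = <-rec (λ s → 2 * r * s ≤ n * points A M s + 2 * r * n) bound
    where
    wind : ∀ {A} → Cyclic A → ∀ s → window A 0 (s + n) ≡ window A 0 s + r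
    wind {A} cA s = trans (window-+ A 0 s n) (cong (window A 0 s +_) (trans (window-periodic (periodic cA) s) (total cA)))
    open ≤-Reasoning
    bound : ∀ s → (∀ {l} → l < s → 2 * r * l ≤ n * points A M l + 2 * r * n) →
            2 * r * s ≤ n * points A M s + 2 * r * n
    bound s ih with s ≤? n
    ... | yes s≤n = ≤-trans (*-monoʳ-≤ (2 * r) s≤n) (m≤n+m _ _)
    ... | no s≰n with s∸n+n ← m∸n+n≡m (<⇒≤ (≰⇒> s≰n)) = begin
      2 * r * s                                        ≡⟨ cong (2 * r *_) (≡-sym s∸n+n) ⟩
      2 * r * (q + n)                                  ≡⟨ *-distribˡ-+ (2 * r) q n ⟩
      2 * r * q + 2 * r * n                            ≤⟨ +-monoˡ-≤ (2 * r * n) (ih q<s) ⟩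
      n * points A M q + 2 * r * n + 2 * r * n         ≡⟨ rearrange n (window A 0 q) (window M 0 q) r ⟩
      n * (window A 0 q + r + (window M 0 q + r)) + 2 * r * n
        ≡⟨ cong (λ x → n * x + 2 * r * n) (cong₂ _+_ (≡-sym (wind cA q)) (≡-sym (wind cM q))) ⟩
      n * points A M (q + n) + 2 * r * n               ≡⟨ cong (λ x → n * points A M x + 2 * r * n) s∸n+n ⟩
      n * points A M s + 2 * r * n                     ∎
      where
      q : ℕ
      q = s ∸ n
      q<s : q < s
      q<s = ∸-monoʳ-< 0<n (<⇒≤ (≰⇒> s≰n))
      rearrange : ∀ n a m r → n * (a + m) + 2 * r * n + 2 * r * n ≡ n * (a + r + (m + r)) + 2 * r * n
      rearrange = solve-∀

  -- Walk from a point of A to the next point of M, from there to the next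
  -- point of A, and so on. If no step had density at least 2r/n, the potential
  -- n · points − 2r · s would decrease for ever.
  walk : ∀ K {A M} → Cyclic A → Cyclic M → ∀ s → A s ≡ true →
         n * points A M s + 2 * r * n ≤ 2 * r * s + K → Run A M ⊎ Run M A
  walk K {A} {M} cA cM s As pot with next cM s
  ... | L , ML , none with 2 * r * L ≤? n * window A s L
  ...   | yes dense = inj₁ (s , L , As , none , ML , dense)
  ...   | no sparse = continue K pot
    where
    open ≤-Reasoning
    points-step : points A M (s + L) ≡ points A M s + window A s L
    points-step = trans (cong₂ _+_ (window-+ A 0 s L)
        (trans (window-+ M 0 s L) (trans (cong (window M 0 s +_) (window-none M s L none)) (+-identityʳ _))))
      (+-swapʳ (window A 0 s) (window A s L) (window M 0 s))
    decrease : ∀ K → n * points A M s + 2 * r * n ≤ 2 * r * s + K →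
               n * points A M (s + L) + 2 * r * n < 2 * r * (s + L) + K
    decrease K pot = begin-strict
      n * points A M (s + L) + 2 * r * n                 ≡⟨ cong (λ x → n * x + 2 * r * n) points-step ⟩
      n * (points A M s + window A s L) + 2 * r * n      ≡⟨ shuffle n (points A M s) (window A s L) (2 * r * n) ⟩
      n * points A M s + 2 * r * n + n * window A s L    <⟨ +-mono-≤-< pot (≰⇒> sparse) ⟩
      2 * r * s + K + 2 * r * L                          ≡⟨ collect (2 * r) s K L ⟩
      2 * r * (s + L) + K                                ∎
      where
      shuffle : ∀ n p w x → n * (p + w) + x ≡ n * p + x + n * w
      shuffle = solve-∀
      collect : ∀ c s K L → c * s + K + c * L ≡ c * (s + L) + K
      collect = solve-∀
    continue : ∀ K → n * points A M s + 2 * r * n ≤ 2 * r * s + K → Run A M ⊎ Run M A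
    -- With `K` used up, one more sparse step takes the potential below the bound of `points-bound`.
    continue zero pot = contradiction (points-bound cA cM (s + L))
      (<⇒≱ (≤-trans (decrease 0 pot) (≤-reflexive (+-identityʳ _))))
    continue (suc K) pot with walk K cM cA (s + L) ML
      (subst (λ x → n * x + 2 * r * n ≤ 2 * r * (s + L) + K) (+-comm (window A 0 (s + L)) _)
        (≤-pred (≤-trans (decrease (suc K) pot) (≤-reflexive (+-suc _ K)))))
    ... | inj₁ run = inj₂ run
    ... | inj₂ run = inj₁ run

  Arc : (ℕ → Bool) → ℕ → Set
  Arc ρ m = ∃ λ x → ∃ λ L → ρ x ≡ true × (∀ i → i < L → ρ (x + m + i) ≡ false) × ρ (x + m + L) ≡ true ×
              2 * r * L ≤ n * window ρ x L

  opaque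
    arc : ∀ {ρ} → Cyclic ρ → ∀ {m} → m ≤ n → Arc ρ m ⊎ Arc ρ (n ∸ m)
    arc {ρ} cρ {m} m≤n with window-witness ρ 0 n (subst (1 ≤_) (≡-sym (total cρ)) 1≤r)
    ... | x , _ , ρx with walk (n * points ρ M x + 2 * r * n) cρ cM x ρx (m≤n+m _ (2 * r * x))
      where
      -- `M` marks the spine vertices shifted forward by `m`, as adding `n ∸ m` subtracts `m` modulo
      -- `n`. A run that starts in `M` gives an arc for `m`, a run that starts in `ρ` one for
      -- `n ∸ m`.
      M : ℕ → Bool
      M p = ρ (p + (n ∸ m))
      cM : Cyclic M
      cM = record
        { periodic = λ p → trans (cong ρ (+-swapʳ p n (n ∸ m))) (periodic cρ (p + (n ∸ m)))
        ; total = trans (window-cong 0 (n ∸ m) n (λ i _ → cong ρ (+-comm i (n ∸ m))))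
                    (trans (window-periodic (periodic cρ) (n ∸ m)) (total cρ))
        }
    ...   | inj₁ (s , L , ρs , none , end , dense) =
      inj₂ (s , L , ρs , (λ i i<L → trans (cong ρ (+-swapʳ s (n ∸ m) i)) (none i i<L)) ,
            trans (cong ρ (+-swapʳ s (n ∸ m) L)) end , dense)
    ...   | inj₂ (s , L , Ms , none , end , dense) =
      inj₁ (s + (n ∸ m) , L , Ms , (λ i i<L → trans (back i) (none i i<L)) , trans (back L) end ,
            subst (λ w → 2 * r * L ≤ n * w) (window-cong s (s + (n ∸ m)) L (λ i _ → cong ρ (+-swapʳ s i (n ∸ m)))) dense)
      where
      back : ∀ i → ρ (s + (n ∸ m) + m + i) ≡ ρ (s + i)
      back i = trans (cong ρ (trans (cong (_+ i) (trans (+-assoc s (n ∸ m) m) (cong (s +_) (m∸n+n≡m m≤n)))) (+-swapʳ s n i)))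
                     (periodic cρ (s + i))

-- Linear and cyclic orders of the vertices

injective⇒surjective : ∀ {n} {f : Fin n → Fin n} → (∀ {x y} → f x ≡ f y → x ≡ y) → ∀ y → ∃ λ x → f x ≡ y
injective⇒surjective {suc n} {f} f-inj y with any? (λ x → f x Fin.≟ y)
... | yes hit = hit
... | no miss = contradiction (injective⇒≤ {f = λ x → punchOut (avoid x)}
    λ eq → f-inj (punchOut-injective (avoid _) (avoid _) eq)) 1+n≰n
  where
  avoid : ∀ x → y ≢ f x
  avoid x eq = miss (x , ≡-sym eq)

opaque
  -- The key `κ u * n + toℕ u` breaks ties by index, so the number of smaller keys is an injective,
  -- hence bijective, placement.
  sorting : ∀ {n} (κ : Fin n → ℕ) →
            Σ (Permutation′ n) λ π → ∀ u v → toℕ (π ⟨$⟩ʳ u) ≤ toℕ (π ⟨$⟩ʳ v) → κ u ≤ κ v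
  sorting {n} κ = permutation place unplace (λ y → proj₂ (injective⇒surjective place-inj y))
      (λ u → place-inj (proj₂ (injective⇒surjective place-inj (place u)))) , monotone
    where
    key : Fin n → ℕ
    key u = κ u * n + toℕ u
    rank : Fin n → ℕ
    rank v = count (λ u → key u <ᵇ key v)
    key-mono : ∀ {u v} → κ u < κ v → key u < key v
    key-mono {u} {v} κ< = begin-strict
      κ u * n + toℕ u   <⟨ +-monoʳ-< (κ u * n) (toℕ<n u) ⟩
      κ u * n + n       ≡⟨ +-comm (κ u * n) n ⟩
      suc (κ u) * n     ≤⟨ *-monoˡ-≤ n κ< ⟩
      κ v * n           ≤⟨ m≤m+n (κ v * n) (toℕ v) ⟩
      key v             ∎
      where open ≤-Reasoning
    key-inj : ∀ {u v} → key u ≡ key v → u ≡ v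
    key-inj {u} {v} eq with <-cmp (κ u) (κ v)
    ... | tri< κ< _ _ = contradiction eq (<⇒≢ (key-mono κ<))
    ... | tri> _ _ κ> = contradiction (≡-sym eq) (<⇒≢ (key-mono κ>))
    ... | tri≈ _ κ≡ _ = toℕ-injective (+-cancelˡ-≡ (κ u * n) _ _ (trans eq (cong (λ x → x * n + toℕ v) (≡-sym κ≡))))
    rank-mono : ∀ {u v} → key u < key v → rank u < rank v
    rank-mono {u} {v} lt = count-strict u
      (λ w w< → <⇒<ᵇ-true (<-trans (<ᵇ-true⇒< {key w} w<) lt)) (≥⇒<ᵇ-false (≤-refl {key u})) (<⇒<ᵇ-true lt)
    rank<n : ∀ v → rank v < n
    rank<n v = subst (rank v <_) (count-full {n} (λ _ → true) (λ _ → refl))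
      (count-strict v (λ _ _ → refl) (≥⇒<ᵇ-false (≤-refl {key v})) refl)
    place : Fin n → Fin n
    place v = fromℕ< (rank<n v)
    toℕ-place : ∀ v → toℕ (place v) ≡ rank v
    toℕ-place v = toℕ-fromℕ< (rank<n v)
    place-inj : ∀ {u v} → place u ≡ place v → u ≡ v
    place-inj {u} {v} eq with <-cmp (key u) (key v) | trans (≡-sym (toℕ-place u)) (trans (cong toℕ eq) (toℕ-place v))
    ... | tri< lt _ _ | same = contradiction same (<⇒≢ (rank-mono lt))
    ... | tri> _ _ gt | same = contradiction (≡-sym same) (<⇒≢ (rank-mono gt))
    ... | tri≈ _ k≡ _ | _    = key-inj k≡
    unplace : Fin n → Fin n
    unplace y = proj₁ (injective⇒surjective place-inj y)
    monotone : ∀ u v → toℕ (place u) ≤ toℕ (place v) → κ u ≤ κ v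
    monotone u v le = ≮⇒≥ λ κ> → <⇒≱ (rank-mono (key-mono κ>))
      (subst₂ _≤_ (toℕ-place u) (toℕ-place v) le)

count-window : ∀ (f : ℕ → Bool) a l → count {l} (λ i → f (a + toℕ i)) ≡ window f a l
count-window f a zero    = refl
count-window f a (suc l) = cong₂ _+_ (cong (b2n ∘ f) (+-identityʳ a))
  (trans (count-cong {l} (λ i → cong f (+-suc a (toℕ i)))) (count-window f (suc a) l))

<ᵇ-cong : ∀ {a b c d} → (a < b → c < d) → (c < d → a < b) → (a <ᵇ b) ≡ (c <ᵇ d)
<ᵇ-cong {a} {b} to from with a <ᵇ b in eq
... | true  = ≡-sym (<⇒<ᵇ-true (to (<ᵇ-true⇒< eq)))
... | false = ≡-sym (≥⇒<ᵇ-false (≮⇒≥ λ lt → <⇒≱ (from lt) (<ᵇ-false⇒≥ eq)))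

module Rotation {n : ℕ} (π : Permutation′ n) where

  pos : Fin n → ℕ
  pos v = toℕ (π ⟨$⟩ʳ v)

  count-pos : ∀ f → count (λ v → f (pos v)) ≡ window f 0 n
  count-pos f = trans (≡-sym (sum-permute (λ i → b2n (f (toℕ i))) π)) (count-window f 0 n)

  rotate : ℕ → ℕ → ℕ
  rotate x p = if p <ᵇ x then p + (n ∸ x) else p ∸ x

  rotate-< : ∀ {x p} → p < x → rotate x p ≡ p + (n ∸ x)
  rotate-< p<x rewrite <⇒<ᵇ-true p<x = refl

  rotate-≥ : ∀ {x p} → x ≤ p → rotate x p ≡ p ∸ x
  rotate-≥ x≤p rewrite ≥⇒<ᵇ-false x≤p = refl

  offset : ℕ → Fin n → ℕ
  offset x v = rotate x (pos v)

  count-offset : ∀ {x} → x ≤ n → ∀ f → count (λ v → f (offset x v)) ≡ window f 0 n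
  count-offset {x} x≤n f = begin
    count (λ v → f (offset x v))                ≡⟨ count-pos (f ∘ rotate x) ⟩
    window (f ∘ rotate x) 0 n                   ≡⟨ cong (window (f ∘ rotate x) 0) (≡-sym (m+[n∸m]≡n x≤n)) ⟩
    window (f ∘ rotate x) 0 (x + (n ∸ x))       ≡⟨ window-+ (f ∘ rotate x) 0 x (n ∸ x) ⟩
    window (f ∘ rotate x) 0 x + window (f ∘ rotate x) x (n ∸ x)
      ≡⟨ cong₂ _+_ (window-cong 0 (n ∸ x) x λ i i<x → cong f (trans (rotate-< i<x) (+-comm i (n ∸ x))))
                   (window-cong x 0 (n ∸ x) λ i _ → cong f (trans (rotate-≥ (m≤m+n x i)) (m+n∸m≡n x i))) ⟩
    window f (n ∸ x) x + window f 0 (n ∸ x)     ≡⟨ +-comm (window f (n ∸ x) x) _ ⟩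
    window f 0 (n ∸ x) + window f (n ∸ x) x     ≡⟨ window-+ f 0 (n ∸ x) x ⟨
    window f 0 (n ∸ x + x)                      ≡⟨ cong (window f 0) (m∸n+n≡m x≤n) ⟩
    window f 0 n                                ∎
    where open ≡-Reasoning

  -- A cut of the circle at offset q is the cut of the line at x + q, reduced
  -- modulo n, up to the cut at x.
  offset-cut : ∀ {G : Graph n} {Q₀ Q : VSet n} {x q k} → x ≤ n → k ≤ n → k ≡ x + q ⊎ k + n ≡ x + q →
    Separates G Q₀ (λ v → pos v <ᵇ x) → Separates G Q (λ v → pos v <ᵇ k) →
    Separates G (λ v → Q₀ v ∨ Q v) (λ v → offset x v <ᵇ q)
  offset-cut {x = x} {q} {k} x≤n k≤n (inj₁ refl) sep₀ sep u v uv u∉ v∉ =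
    trans (side u) (trans (cong₂ (λ a b → if a then false else b) (sep₀ u v uv (proj₁ (∨-false u∉)) (proj₁ (∨-false v∉)))
      (sep u v uv (proj₂ (∨-false u∉)) (proj₂ (∨-false v∉)))) (≡-sym (side v)))
    where
    side : ∀ v → (offset x v <ᵇ q) ≡ (if pos v <ᵇ x then false else (pos v <ᵇ x + q))
    side v with pos v <ᵇ x in eq
    ... | true  = ≥⇒<ᵇ-false (≤-trans (m+n≤o⇒m≤o∸n q (subst (_≤ n) (+-comm x q) k≤n)) (m≤n+m (n ∸ x) (pos v)))
    ... | false = <ᵇ-cong
      (λ lt → subst (_< x + q) (m+[n∸m]≡n x≤p) (+-monoʳ-< x lt))
      (λ lt → +-cancelˡ-< x _ _ (subst (_< x + q) (≡-sym (m+[n∸m]≡n x≤p)) lt))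
      where
      x≤p : x ≤ pos v
      x≤p = <ᵇ-false⇒≥ eq
  offset-cut {x = x} {q} {k} x≤n k≤n (inj₂ k+n) sep₀ sep u v uv u∉ v∉ =
    trans (side u) (trans (cong₂ (λ a b → if a then b else true) (sep₀ u v uv (proj₁ (∨-false u∉)) (proj₁ (∨-false v∉)))
      (sep u v uv (proj₂ (∨-false u∉)) (proj₂ (∨-false v∉)))) (≡-sym (side v)))
    where
    wrap : ∀ p → x + (p + (n ∸ x)) ≡ p + n
    wrap p = trans (+-comm x _) (trans (+-assoc p (n ∸ x) x) (cong (p +_) (m∸n+n≡m x≤n)))
    side : ∀ v → (offset x v <ᵇ q) ≡ (if pos v <ᵇ x then (pos v <ᵇ k) else true)
    side v with pos v <ᵇ x in eq
    ... | true  = <ᵇ-cong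
      (λ lt → +-cancelʳ-< n _ _ (subst₂ _<_ (wrap (pos v)) (≡-sym k+n) (+-monoʳ-< x lt)))
      (λ lt → +-cancelˡ-< x _ _ (subst₂ _<_ (≡-sym (wrap (pos v))) k+n (+-monoˡ-< n lt)))
    ... | false = <⇒<ᵇ-true (+-cancelˡ-< x _ _ (subst₂ _<_ (≡-sym (m+[n∸m]≡n (<ᵇ-false⇒≥ {pos v} {x} eq))) k+n
                    (<-≤-trans (toℕ<n (π ⟨$⟩ʳ v)) (m≤n+m n k))))

  module Cyclic-colour (R : VSet n) .{{_ : NonZero n}} where

    vertexAt : ℕ → Fin n
    vertexAt p = π ⟨$⟩ˡ (p mod n)

    -- The circle is unrolled into a periodic word, so that arcs become intervals of `ℕ`.
    ρ : ℕ → Bool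
    ρ p = R (vertexAt p)

    pos-vertexAt : ∀ p → pos (vertexAt p) ≡ p % n
    pos-vertexAt p = trans (cong toℕ (inverseʳ π)) (toℕ-fromℕ< (m%n<n p n))

    ρ-cong : ∀ {p p′} → p % n ≡ p′ % n → ρ p ≡ ρ p′
    ρ-cong {p} {p′} eq = cong (λ i → R (π ⟨$⟩ˡ i))
      (toℕ-injective (trans (toℕ-fromℕ< (m%n<n p n)) (trans eq (≡-sym (toℕ-fromℕ< (m%n<n p′ n))))))

    ρ-periodic : Periodic n ρ
    ρ-periodic p = ρ-cong ([m+n]%n≡m%n p n)

    ρ-reduce : ∀ x i → ρ (x % n + i) ≡ ρ (x + i)
    ρ-reduce x i = ρ-cong (trans (%-distribˡ-+ (x % n) i n)
      (trans (cong (λ y → (y + i % n) % n) (m%n%n≡m%n x n)) (≡-sym (%-distribˡ-+ x i n))))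

    ρ-pos : ∀ v → ρ (pos v) ≡ R v
    ρ-pos v = cong R (trans (cong (π ⟨$⟩ˡ_) (toℕ-injective
      (trans (toℕ-fromℕ< (m%n<n (pos v) n)) (m<n⇒m%n≡m (toℕ<n (π ⟨$⟩ʳ v)))))) (inverseˡ π))

    ρ-total : window ρ 0 n ≡ count R
    ρ-total = trans (≡-sym (count-pos ρ)) (count-cong ρ-pos)

    ρ-offset : ∀ {x} → x ≤ n → ∀ v → ρ (x + offset x v) ≡ R v
    ρ-offset {x} x≤n v with <-≤-connex (pos v) x
    ... | inj₁ p<x rewrite rotate-< p<x = trans (cong ρ (trans (+-comm x _) (trans (+-assoc (pos v) (n ∸ x) x)
                             (cong (pos v +_) (m∸n+n≡m x≤n))))) (trans (ρ-periodic (pos v)) (ρ-pos v))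
    ... | inj₂ x≤p rewrite rotate-≥ x≤p = trans (cong ρ (m+[n∸m]≡n x≤p)) (ρ-pos v)

    pos-vertexAt-wrap : ∀ p → p < n + n → pos (vertexAt p) ≡ p ⊎ pos (vertexAt p) + n ≡ p
    pos-vertexAt-wrap p p<2n with <-≤-connex p n
    ... | inj₁ p<n = inj₁ (trans (pos-vertexAt p) (m<n⇒m%n≡m p<n))
    ... | inj₂ n≤p = inj₂ (trans (cong (_+ n) (trans (pos-vertexAt p)
            (trans (cong (_% n) (≡-sym (m∸n+n≡m n≤p))) (trans ([m+n]%n≡m%n (p ∸ n) n)
              (m<n⇒m%n≡m (+-cancelʳ-< n _ _ (subst (_< n + n) (≡-sym (m∸n+n≡m n≤p)) p<2n)))))))
          (m∸n+n≡m n≤p))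

-- The order of the vertices along the spine

window-full : ∀ ρ a l → (∀ i → i < l → ρ (a + i) ≡ true) → window ρ a l ≡ l
window-full ρ a zero    full = refl
window-full ρ a (suc l) full = cong₂ _+_ (cong b2n (trans (cong ρ (≡-sym (+-identityʳ a))) (full 0 (s≤s z≤n))))
  (window-full ρ (suc a) l λ i i<l → trans (cong ρ (≡-sym (+-suc a i))) (full (suc i) (s≤s i<l)))

last-true : ∀ ρ a L → ρ a ≡ true →
            ∃ λ e → e ≤ L × ρ (a + e) ≡ true × window ρ a (suc e) ≡ window ρ a (suc L)
last-true ρ a zero ρa = 0 , z≤n , trans (cong ρ (+-identityʳ a)) ρa , refl
last-true ρ a (suc L) ρa with ρ (a + suc L) in eq | last-true ρ a L ρa
... | true  | _ = suc L , ≤-refl , eq , refl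
... | false | e , e≤L , ρe , same =
  e , ≤-trans e≤L (n≤1+n L) , ρe , trans same (≡-sym (trans (cong (window ρ a) (+-comm 1 (suc L)))
    (trans (window-+ ρ a (suc L) 1) (trans (cong (λ b → window ρ a (suc L) + (b2n b + 0)) eq) (+-identityʳ _)))))

opaque
  -- Take the least `j`. If it is positive, the preceding power fails, `2 ^ (j - 1) * d < L`, and
  -- the density hypothesis turns this into `2 ^ j * r ≤ n`; its factor 2 pays for rounding `j` up.
  halvings : ∀ n r d L c → 1 ≤ d → r ≤ n → c ≤ d → 2 * r * L ≤ n * c → ∃ λ j → L ≤ 2 ^ j * d × 2 ^ j * r ≤ n
  halvings n r d@(suc _) L c 1≤d r≤n c≤d dense with least (λ j → L ≤? 2 ^ j * d) L enough
    where
    enough : L ≤ 2 ^ L * d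
    enough = ≤-trans (<⇒≤ (n<2^n L)) (m≤m*n (2 ^ L) d)
      where
      n<2^n : ∀ n → n < 2 ^ n
      n<2^n zero    = s≤s z≤n
      n<2^n (suc n) = ≤-trans (+-mono-≤ (≤-trans (s≤s z≤n) (n<2^n n)) (n<2^n n))
                        (≤-reflexive (cong (2 ^ n +_) (≡-sym (+-identityʳ (2 ^ n)))))
  ... | zero  , L≤ , _ , _   = 0 , L≤ , ≤-trans (≤-reflexive (+-identityʳ r)) r≤n
  ... | suc j , L≤ , _ , low = suc j , L≤ , *-cancelʳ-≤ _ n d (begin
      2 ^ suc j * r * d     ≡⟨ rearrange (2 ^ j) r d ⟩
      2 * r * (2 ^ j * d)   ≤⟨ *-monoʳ-≤ (2 * r) (<⇒≤ (≰⇒> (low j ≤-refl))) ⟩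
      2 * r * L             ≤⟨ dense ⟩
      n * c                 ≤⟨ *-monoʳ-≤ n c≤d ⟩
      n * d                 ∎)
    where
    open ≤-Reasoning
    rearrange : ∀ p r d → (2 * p) * r * d ≡ 2 * r * (p * d)
    rearrange = solve-∀

module _ {n : ℕ} {G : Graph n} where

  Separates-mono : ∀ {A : Set} {Q Q′ : VSet n} {f : Fin n → A} → (∀ v → Q v ≡ true → Q′ v ≡ true) →
                   Separates G Q f → Separates G Q′ f
  Separates-mono {Q = Q} {Q′} Q⊆Q′ sep u v uv u∉ v∉ = sep u v uv (out u u∉) (out v v∉)
    where
    out : ∀ v → Q′ v ≡ false → Q v ≡ false
    out v v∉ = ¬-not λ v∈ → true≢false (Q⊆Q′ v v∈) v∉

∨-trueˡ : ∀ {a} b → a ≡ true → (a ∨ b) ≡ true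
∨-trueˡ b refl = refl

∨-trueʳ : ∀ a {b} → b ≡ true → (a ∨ b) ≡ true
∨-trueʳ true  _    = refl
∨-trueʳ false refl = refl

∨-case : ∀ {a b} {C : Set} → (a ≡ true → C) → (b ≡ true → C) → (a ∨ b) ≡ true → C
∨-case {true}  f g _  = f refl
∨-case {false} f g eq = g eq

module SpineOrder {n : ℕ} {G : Graph n} (R : Rooted G (λ _ → true)) (ℓ : ℕ)
                  (spine : ∀ i → suc i ≤ ℓ → Rooted.par R (suc i) ≡ i) where
  open RootedProperties R
  open Spine R ℓ spine using (spine-≼)

  opaque
    spineHead : ∀ j → ∃ λ h → h ≤ ℓ × h ≼ j × (∀ h′ → h′ ≤ ℓ → h′ ≼ j → h′ ≤ h)
    spineHead = <-rec _ find
      where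
      find : ∀ j → (∀ {l} → l < j → ∃ λ h → h ≤ ℓ × h ≼ l × (∀ h′ → h′ ≤ ℓ → h′ ≼ l → h′ ≤ h)) →
             ∃ λ h → h ≤ ℓ × h ≼ j × (∀ h′ → h′ ≤ ℓ → h′ ≼ j → h′ ≤ h)
      find j rec with j ≤? ℓ
      find j       rec | yes j≤ℓ = j , j≤ℓ , here , λ _ _ → ≼⇒≤
      find zero    rec | no j≰ℓ  = contradiction z≤n j≰ℓ
      find (suc j) rec | no j≰ℓ with h , h≤ℓ , h≼p , max ← rec (s≤s (par≤ j)) =
        h , h≤ℓ , down h≼p , λ h′ h′≤ℓ h′≼j → max h′ h′≤ℓ (≼-par h′≼j λ { refl → j≰ℓ h′≤ℓ })

  onSpine : VSet n
  onSpine v = top v ≤ᵇ ℓ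

  onSpine⇒≤ : ∀ {v} → onSpine v ≡ true → top v ≤ ℓ
  onSpine⇒≤ {v} eq = ≤ᵇ⇒≤ (top v) ℓ (Equivalence.from T-≡ eq)

  ≤⇒onSpine : ∀ {v} → top v ≤ ℓ → onSpine v ≡ true
  ≤⇒onSpine le = Equivalence.to T-≡ (≤⇒≤ᵇ le)

  head : Fin n → ℕ
  head v = proj₁ (spineHead (top v))

  -- Vertices are listed branch by branch along the spine; within a branch the
  -- vertices whose top is the spine node itself come first.
  κ : Fin n → ℕ
  κ v = 2 * head v + b2n (not (onSpine v))

  κ-spine : ∀ {w} → top w ≤ ℓ → κ w ≡ 2 * top w
  κ-spine {w} t≤ℓ with h , _ , h≼t , max ← spineHead (top w) rewrite ≤⇒onSpine {w} t≤ℓ =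
    trans (+-identityʳ _) (cong (2 *_) (≤-antisym (≼⇒≤ h≼t) (max (top w) t≤ℓ here)))

  κ-low : ∀ {a h} → h ≤ ℓ → κ a ≤ 2 * h → h ≼ top a → top a ≡ h
  κ-low {a} {h} h≤ℓ κ≤ h≼a with g , _ , _ , max ← spineHead (top a) with onSpine a in eq
  ... | true  = ≤-antisym (≤-trans (max (top a) (onSpine⇒≤ {a} eq) here)
                  (*-cancelˡ-≤ 2 (≤-trans (m≤m+n (2 * g) 0) κ≤))) (≼⇒≤ h≼a)
  ... | false = contradiction (≤-trans (≤-trans (≤-reflexive (+-comm 1 (2 * g))) κ≤) (*-monoʳ-≤ 2 (max h h≤ℓ h≼a))) 1+n≰n

  κ-high : ∀ {b h} → 2 * h ≤ κ b → h ≼ top b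
  κ-high {b} {h} ≤κ with g , g≤ℓ , g≼b , _ ← spineHead (top b) =
    ≼-trans (spine-≼ g (≮⇒≥ λ g<h → <⇒≱ (gap g<h) ≤κ) g≤ℓ) g≼b
    where
    gap : g < h → 2 * g + b2n (not (onSpine b)) < 2 * h
    gap g<h = begin-strict
      2 * g + b2n (not (onSpine b))   ≤⟨ +-monoʳ-≤ (2 * g) (b2n≤1 (not (onSpine b))) ⟩
      2 * g + 1                       <⟨ ≤-reflexive (double g) ⟩
      2 * suc g                       ≤⟨ *-monoʳ-≤ 2 g<h ⟩
      2 * h                           ∎
      where
      open ≤-Reasoning
      double : ∀ g → suc (2 * g + 1) ≡ 2 * suc g
      double = solve-∀

  -- If the top of `a` is below that of `w`, the two tops coincide, because spine vertices come
  -- first in their branch. Otherwise the edge joins the descendants of `top w`, which contain the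
  -- top of `b`, to the outside, and then `a` lies in the bag there.
  spine-cut : ∀ {w a b} → top w ≤ ℓ → adj G a b ≡ true → κ a ≤ κ w → κ w ≤ κ b →
              X (top w) a ≡ true ⊎ X (top w) b ≡ true
  spine-cut {w} {a} {b} w≤ℓ ab a≤w w≤b with top w ≼? top a
  ... | yes w≼a = inj₁ (subst (λ i → X i a ≡ true)
                    (κ-low w≤ℓ (≤-trans a≤w (≤-reflexive (κ-spine {w} w≤ℓ))) w≼a) (top∈ refl))
  ... | no w⋠a with w≼b ← κ-high {b} (≤-trans (≤-reflexive (≡-sym (κ-spine {w} w≤ℓ))) w≤b) with edge-top refl refl ab
  ...   | inj₂ b∈ = contradiction (≼-trans w≼b (top≼ b∈)) w⋠a
  ...   | inj₁ a∈ with X-between a∈ w≼b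
  ...     | inj₁ a∈w = inj₁ a∈w
  ...     | inj₂ w≼a = contradiction w≼a w⋠a

  π : Permutation′ n
  π = proj₁ (sorting κ)

  open Rotation π public

  no-crossing : ∀ {w a b k} → top w ≤ ℓ → k ≡ pos w ⊎ k ≡ suc (pos w) → adj G a b ≡ true →
                X (top w) a ≡ false → X (top w) b ≡ false → pos a < k → ¬ k ≤ pos b
  no-crossing {w} {a} {b} w≤ℓ k≡ ab a∉ b∉ a<k k≤b
    with spine-cut {w} w≤ℓ ab (proj₂ (sorting κ) a w (left k≡ a<k)) (proj₂ (sorting κ) w b (right k≡ k≤b))
    where
    left : ∀ {k p q} → k ≡ p ⊎ k ≡ suc p → q < k → q ≤ p
    left (inj₁ refl) = <⇒≤
    left (inj₂ refl) = ≤-pred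
    right : ∀ {k p q} → k ≡ p ⊎ k ≡ suc p → k ≤ q → p ≤ q
    right (inj₁ refl) = id
    right (inj₂ refl) = <⇒≤
  ... | inj₁ a∈ = true≢false a∈ a∉
  ... | inj₂ b∈ = true≢false b∈ b∉

  -- Both sides of `w` occur: arcs start and stop just before a spine vertex, while `Z` stops just
  -- after its last one.
  vertex-cut : ∀ {w} → top w ≤ ℓ → ∀ {k} → k ≡ pos w ⊎ k ≡ suc (pos w) → Separates G (X (top w)) (λ v → pos v <ᵇ k)
  vertex-cut {w} w≤ℓ {k} k≡ u v uv u∉ v∉ with pos u <ᵇ k in eu | pos v <ᵇ k in ev
  ... | true  | true  = refl
  ... | false | false = refl
  ... | true  | false = contradiction (<ᵇ-false⇒≥ ev) (no-crossing {w} w≤ℓ k≡ uv u∉ v∉ (<ᵇ-true⇒< eu))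
  ... | false | true  = contradiction (<ᵇ-false⇒≥ eu)
                          (no-crossing {w} w≤ℓ k≡ (trans (Graph.sym G v u) uv) v∉ u∉ (<ᵇ-true⇒< ev))

-- The partition

module Partition {n : ℕ} {G : Graph n} (R : Rooted G (λ _ → true)) (ℓ : ℕ)
                 (spine : ∀ i → suc i ≤ ℓ → Rooted.par R (suc i) ≡ i)
                 (t : ℕ) (width : ∀ i → count (Rooted.X R i) ≤ t)
                 .{{_ : NonZero n}} (1≤r : 1 ≤ count (λ v → Rooted.top R v ≤ᵇ ℓ)) (0<n : 0 < n) where
  open RootedProperties R
  open SpineOrder R ℓ spine
  open Cyclic-colour onSpine
  open Halving R using (approximate)

  r : ℕ
  r = count onSpine

  open Circle n 0<n r 1≤r

  -- In `Q-bags`, the 3 stands for the start of the circle, the end of `Z` and the end of the arc;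
  -- `steps` counts the halvings.
  record Approximation (m : ℕ) (B Z Q : VSet n) : Set where
    field
      lower   : count B ≤ m
      upper   : m ≤ count B + count Z
      Z-small : 2 * count Z ≤ n
      steps   : ℕ
      Q-bags  : count Q ≤ (3 + steps) * t
      steps-≤ : 2 ^ steps * r ≤ n
      Z-spine : ∃ λ v → Z v ≡ true × top v ≤ ℓ
      Z-dense : 2 * r * count Z ≤ n * count (λ v → Z v ∧ onSpine v)

  record Outcome (m : ℕ) : Set where
    field
      B Z Q    : VSet n
      disjoint : ∀ v → Z v ≡ true → B v ≡ false
      sep-B    : Separates G Q B
      sep-Z    : Separates G Q Z
      sizes    : (count B ≡ m × (∀ v → Z v ≡ false) × count Q ≤ 2 * t) ⊎ Approximation m B Z Q

  -- The two size conditions are exchanged when `B` is replaced by the remaining part `W`, since the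
  -- three parts add up to `n`; `Z` and `Q` stay the same.
  complement : ∀ {m} → m ≤ n → Outcome (n ∸ m) → Outcome m
  complement {m} m≤n o = record
    { B = W ; Z = Z ; Q = Q
    ; disjoint = λ v v∈Z → cong (λ z → not (z ∨ B v)) v∈Z
    ; sep-B = λ u v uv u∉ v∉ → cong₂ (λ a b → not (a ∨ b)) (sep-Z u v uv u∉ v∉) (sep-B u v uv u∉ v∉)
    ; sep-Z = sep-Z
    ; sizes = flip-sizes sizes
    }
    where
    open Outcome o
    W : VSet n
    W v = not (Z v ∨ B v)
    total : n ≡ count Z + count B + count W
    total = trans (≡-sym (count-full {n} (λ _ → true) λ _ → refl))
      (trans (count-+ λ v → split (Z v ∨ B v)) (cong (_+ count W) (count-∨ Z B disjoint)))
      where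
      split : ∀ b → 1 ≡ b2n b + b2n (not b)
      split true  = refl
      split false = refl
    flip-sizes : (count B ≡ n ∸ m × (∀ v → Z v ≡ false) × count Q ≤ 2 * t) ⊎ Approximation (n ∸ m) B Z Q →
                 (count W ≡ m × (∀ v → Z v ≡ false) × count Q ≤ 2 * t) ⊎ Approximation m W Z Q
    flip-sizes (inj₁ (B≡ , empty , Q≤)) = inj₁ (+-cancelˡ-≡ (n ∸ m) _ _ (begin
        (n ∸ m) + count W           ≡⟨ cong₂ (λ z b → z + b + count W) (≡-sym (count-none Z empty)) (≡-sym B≡) ⟩
        count Z + count B + count W ≡⟨ total ⟨
        n                           ≡⟨ m∸n+n≡m m≤n ⟨
        (n ∸ m) + m                 ∎) , empty , Q≤)
      where open ≡-Reasoning
    flip-sizes (inj₂ a) = inj₂ record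
      { lower = +-cancelˡ-≤ (n ∸ m) _ _ (begin
          (n ∸ m) + count W             ≤⟨ +-monoˡ-≤ (count W) upper ⟩
          count B + count Z + count W   ≡⟨ cong (_+ count W) (+-comm (count B) (count Z)) ⟩
          count Z + count B + count W   ≡⟨ total ⟨
          n                             ≡⟨ m∸n+n≡m m≤n ⟨
          (n ∸ m) + m                   ∎)
      ; upper = +-cancelʳ-≤ (n ∸ m) _ _ (begin
          m + (n ∸ m)                   ≡⟨ m+[n∸m]≡n m≤n ⟩
          n                             ≡⟨ total ⟩
          count Z + count B + count W   ≡⟨ shuffle (count Z) (count B) (count W) ⟩
          count W + count Z + count B   ≤⟨ +-monoʳ-≤ (count W + count Z) lower ⟩
          count W + count Z + (n ∸ m)   ∎)
      ; Z-small = Z-small ; steps = steps ; Q-bags = Q-bags ; steps-≤ = steps-≤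
      ; Z-spine = Z-spine ; Z-dense = Z-dense }
      where
      open Approximation a
      open ≤-Reasoning
      shuffle : ∀ z b w → z + b + w ≡ w + z + b
      shuffle = solve-∀

  module At (x₀ : ℕ) (ρx₀ : ρ x₀ ≡ true) where

    x : ℕ
    x = x₀ % n

    x<n : x < n
    x<n = m%n<n x₀ n

    σ : ℕ → Bool
    σ i = ρ (x + i)

    σ≡ρ : ∀ i → σ i ≡ ρ (x₀ + i)
    σ≡ρ = ρ-reduce x₀

    o : Fin n → ℕ
    o = offset x

    σ-o : ∀ v → σ (o v) ≡ onSpine v
    σ-o = ρ-offset (<⇒≤ x<n)

    base : Fin n
    base = vertexAt x₀

    base≤ℓ : top base ≤ ℓ
    base≤ℓ = onSpine⇒≤ {base} ρx₀

    base-cut : Separates G (X (top base)) (λ v → pos v <ᵇ x)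
    base-cut = vertex-cut {base} base≤ℓ (inj₁ (≡-sym (pos-vertexAt x₀)))

    cut-before : ∀ q → q ≤ n → σ q ≡ true →
      ∃ λ i → Separates G (λ v → X (top base) v ∨ X i v) (λ v → o v <ᵇ q)
    cut-before q q≤n σq = top w , offset-cut {G = G} (<⇒≤ x<n) (<⇒≤ (toℕ<n (π ⟨$⟩ʳ w)))
        (pos-vertexAt-wrap (x + q) (+-mono-<-≤ x<n q≤n))
        base-cut (vertex-cut {w} (onSpine⇒≤ {w} σq) (inj₁ refl))
      where
      w : Fin n
      w = vertexAt (x + q)

    cut-after : ∀ e → e < n → σ e ≡ true →
      ∃ λ i → Separates G (λ v → X (top base) v ∨ X i v) (λ v → o v <ᵇ suc e)
    cut-after e e<n σe = top w , offset-cut {G = G} (<⇒≤ x<n) (toℕ<n (π ⟨$⟩ʳ w))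
        (shift (pos-vertexAt-wrap (x + e) (+-mono-<-≤ x<n (<⇒≤ e<n))))
        base-cut (vertex-cut {w} (onSpine⇒≤ {w} σe) (inj₂ refl))
      where
      w : Fin n
      w = vertexAt (x + e)
      shift : pos w ≡ x + e ⊎ pos w + n ≡ x + e → suc (pos w) ≡ x + suc e ⊎ suc (pos w) + n ≡ x + suc e
      shift (inj₁ eq) = inj₁ (trans (cong suc eq) (≡-sym (+-suc x e)))
      shift (inj₂ eq) = inj₂ (trans (cong suc eq) (≡-sym (+-suc x e)))

    Upto : ℕ → VSet n
    Upto q v = o v <ᵇ q

    count-below : ∀ f q → q ≤ n → count (λ v → Upto q v ∧ f (o v)) ≡ window f 0 q
    count-below f q q≤n = begin
      count (λ v → Upto q v ∧ f (o v))           ≡⟨ count-offset (<⇒≤ x<n) g ⟩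
      window g 0 n                               ≡⟨ cong (window g 0) (≡-sym (m+[n∸m]≡n q≤n)) ⟩
      window g 0 (q + (n ∸ q))                   ≡⟨ window-+ g 0 q (n ∸ q) ⟩
      window g 0 q + window g q (n ∸ q)
        ≡⟨ cong₂ _+_ (window-cong 0 0 q λ i i<q → cong (_∧ f i) (<⇒<ᵇ-true i<q))
                     (window-none g q (n ∸ q) λ i _ → cong (_∧ f (q + i)) (≥⇒<ᵇ-false (m≤m+n q i))) ⟩
      window f 0 q + 0                           ≡⟨ +-identityʳ _ ⟩
      window f 0 q                               ∎
      where
      open ≡-Reasoning
      g : ℕ → Bool
      g i = (i <ᵇ q) ∧ f i

    count-Upto : ∀ q → q ≤ n → count (Upto q) ≡ q
    count-Upto q q≤n = trans (count-cong λ v → ≡-sym (∧-identityʳ (Upto q v)))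
      (trans (count-below (λ _ → true) q q≤n) (window-full (λ _ → true) 0 q λ _ _ → refl))

    exact : ∀ m → m ≤ n → ρ (x₀ + m) ≡ true → Outcome m
    exact m m≤n end with i , sep ← cut-before m m≤n (trans (σ≡ρ m) end) = record
      { B = Upto m ; Z = λ _ → false ; Q = λ v → X (top base) v ∨ X i v
      ; disjoint = λ v () ; sep-B = sep ; sep-Z = λ _ _ _ _ _ → refl
      ; sizes = inj₁ (count-Upto m m≤n , (λ _ → refl) ,
          ≤-trans (count-∨-≤ (X (top base)) (X i))
            (+-mono-≤ (width (top base)) (≤-trans (width i) (≤-reflexive (≡-sym (+-identityʳ t)))))) }

    -- Z is the arc from x to the last spine vertex before x + L; a set A of between
    -- L − |Z| and L vertices is moved from the arc following Z, which ends at
    -- x + m + L, to the rest of the circle, so that B has the right size.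
    approximation : ∀ m L → m ≤ n → (∀ i → i < suc L → ρ (x₀ + m + i) ≡ false) → ρ (x₀ + m + suc L) ≡ true →
                    2 * r * suc L ≤ n * window ρ x₀ (suc L) → Outcome m
    approximation m L′ m≤n none end dense
      with e , e≤L′ , ρe , same ← last-true ρ x₀ L′ ρx₀ = result
      where
      open ≤-Reasoning
      L d : ℕ
      L = suc L′
      d = suc e

      -- Otherwise the last spine vertex of `Z` would lie in the spine-free stretch from `x₀ + m`.
      d≤m : d ≤ m
      d≤m = ≰⇒> λ m≤e → true≢false ρe (trans (cong ρ (trans (cong (x₀ +_) (≡-sym (m+[n∸m]≡n m≤e))) (≡-sym (+-assoc x₀ m (e ∸ m)))))
                          (none (e ∸ m) (s≤s (≤-trans (m∸n≤m e m) e≤L′))))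

      -- Otherwise the spine-free stretch would run around the circle over `x₀`. With `d ≤ m` and
      -- `d ≤ L` this gives `2 * d ≤ n`.
      m+L≤n : m + L ≤ n
      m+L≤n = ≮⇒≥ λ n<m+L → true≢false ρx₀ (trans (≡-sym (ρ-periodic x₀))
        (trans (cong ρ (trans (cong (x₀ +_) (≡-sym (m+[n∸m]≡n m≤n))) (≡-sym (+-assoc x₀ m (n ∸ m)))))
          (none (n ∸ m) (+-cancelˡ-< m _ _ (subst (_< m + L) (≡-sym (m+[n∸m]≡n m≤n)) n<m+L)))))

      d≤L : d ≤ L
      d≤L = s≤s e≤L′

      d≤n : d ≤ n
      d≤n = ≤-trans d≤m m≤n

      Z U : VSet n
      Z = Upto d
      U v = Upto (m + L) v ∧ not (Z v)

      count-Z : count Z ≡ d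
      count-Z = count-Upto d d≤n

      count-U : m + L ≡ d + count U
      count-U = trans (≡-sym (count-Upto (m + L) m+L≤n))
        (trans (count-∖ (Upto (m + L)) Z λ v v∈ → <⇒<ᵇ-true
          (<-≤-trans (<ᵇ-true⇒< {o v} v∈) (≤-trans d≤m (m≤m+n m L)))) (cong (_+ count U) count-Z))

      L≤U : L ≤ count U
      L≤U = +-cancelˡ-≤ d _ _ (≤-trans (+-monoˡ-≤ L d≤m) (≤-reflexive count-U))

      spine-Z : count (λ v → Z v ∧ onSpine v) ≡ window ρ x₀ L
      spine-Z = trans (count-cong λ v → cong (Z v ∧_) (≡-sym (σ-o v)))
        (trans (count-below σ d d≤n) (trans (window-cong 0 x₀ d λ i _ → σ≡ρ i) same))

      j-spec : ∃ λ j → L ≤ 2 ^ j * d × 2 ^ j * r ≤ n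
      j-spec = halvings n r d L (window ρ x₀ L) (s≤s z≤n) (count-≤ onSpine)
        (subst (_≤ d) same (window-≤ ρ x₀ d)) dense

      cut-d : ∃ λ i → Separates G (λ v → X (top base) v ∨ X i v) Z
      cut-d = cut-after e d≤n (trans (σ≡ρ e) ρe)

      cut-m+L : ∃ λ i → Separates G (λ v → X (top base) v ∨ X i v) (Upto (m + L))
      cut-m+L = cut-before (m + L) m+L≤n (trans (σ≡ρ (m + L)) (trans (cong ρ (≡-sym (+-assoc x₀ m L))) end))

      result : Outcome m
      result with j , L≤ , 2^j≤ ← j-spec with i₁ , sep₁ ← cut-d with i₂ , sep₂ ← cut-m+L
        with A , Q₀ , A⊆U , A≤L , L≤A , Q₀≤ , cut ← approximate width d j U L L≤ L≤U = record
        { B = B ; Z = Z ; Q = Q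
        ; disjoint = λ v v∈Z → cong (_∧ not (A v)) (trans (cong (λ z → Upto (m + L) v ∧ not z) v∈Z) (∧-zeroʳ (Upto (m + L) v)))
        ; sep-B = sep-B
        ; sep-Z = sep-Z
        ; sizes = inj₂ record
          { lower = +-cancelʳ-≤ L _ _ (begin
              count B + L               ≤⟨ +-monoʳ-≤ (count B) L≤A ⟩
              count B + (count A + d)   ≡⟨ shuffle (count B) (count A) d ⟩
              d + (count A + count B)   ≡⟨ sum-eq ⟨
              m + L                     ∎)
          ; upper = +-cancelʳ-≤ L _ _ (begin
              m + L                     ≡⟨ sum-eq ⟩
              d + (count A + count B)   ≤⟨ +-monoʳ-≤ d (+-monoˡ-≤ (count B) A≤L) ⟩
              d + (L + count B)         ≡⟨ shuffle′ d L (count B) ⟩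
              count B + d + L           ≡⟨ cong (λ z → count B + z + L) (≡-sym count-Z) ⟩
              count B + count Z + L     ∎)
          ; Z-small = begin
              2 * count Z   ≡⟨ cong (2 *_) count-Z ⟩
              d + (d + 0)   ≡⟨ cong (d +_) (+-identityʳ d) ⟩
              d + d         ≤⟨ +-mono-≤ d≤m d≤L ⟩
              m + L         ≤⟨ m+L≤n ⟩
              n             ∎
          ; steps = j
          ; Q-bags = Q-bags
          ; steps-≤ = 2^j≤
          ; Z-spine = Z-spine
          ; Z-dense = begin
              2 * r * count Z                          ≡⟨ cong (2 * r *_) count-Z ⟩
              2 * r * d                                ≤⟨ *-monoʳ-≤ (2 * r) d≤L ⟩
              2 * r * L                                ≤⟨ dense ⟩
              n * window ρ x₀ L                        ≡⟨ cong (n *_) spine-Z ⟨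
              n * count (λ v → Z v ∧ onSpine v)        ∎
          }
        }
        where
        B Q : VSet n
        B v = U v ∧ not (A v)
        Q v = (X (top base) v ∨ X i₁ v) ∨ (X i₂ v ∨ Q₀ v)
        Q-bags : count Q ≤ (3 + j) * t
        Q-bags = begin
          count Q                                               ≤⟨ count-∨-≤ (λ v → X (top base) v ∨ X i₁ v) (λ v → X i₂ v ∨ Q₀ v) ⟩
          count (λ v → X (top base) v ∨ X i₁ v) + count (λ v → X i₂ v ∨ Q₀ v)
            ≤⟨ +-mono-≤ (count-∨-≤ (X (top base)) (X i₁)) (count-∨-≤ (X i₂) Q₀) ⟩
          count (X (top base)) + count (X i₁) + (count (X i₂) + count Q₀)
            ≤⟨ +-mono-≤ (+-mono-≤ (width (top base)) (width i₁)) (+-mono-≤ (width i₂) Q₀≤) ⟩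
          t + t + (t + j * t)                                   ≡⟨ +-assoc t t (t + j * t) ⟩
          (3 + j) * t                                           ∎
        sum-eq : m + L ≡ d + (count A + count B)
        sum-eq = trans count-U (cong (d +_) (count-∖ U A A⊆U))
        shuffle : ∀ b a d → b + (a + d) ≡ d + (a + b)
        shuffle = solve-∀
        shuffle′ : ∀ d l b → d + (l + b) ≡ b + d + l
        shuffle′ = solve-∀
        sep-Z : Separates G Q Z
        sep-Z = Separates-mono {G = G} (λ v → ∨-trueˡ (X i₂ v ∨ Q₀ v)) sep₁
        sep-U : Separates G Q (Upto (m + L))
        sep-U = Separates-mono {G = G} (λ v → ∨-case {X (top base) v} {X i₂ v}
          (λ v∈ → ∨-trueˡ (X i₂ v ∨ Q₀ v) (∨-trueˡ (X i₁ v) v∈))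
          (λ v∈ → ∨-trueʳ (X (top base) v ∨ X i₁ v) (∨-trueˡ (Q₀ v) v∈))) sep₂
        sep-B : Separates G Q B
        sep-B u v uv u∉ v∉
          with U u in u∈ | U v in v∈ | cong₂ (λ a z → a ∧ not z) (sep-U u v uv u∉ v∉) (sep-Z u v uv u∉ v∉)
        ... | true  | true  | _ = cong not (cut u v uv u∈ v∈
                (proj₂ (∨-false {X i₂ u} (proj₂ (∨-false {X (top base) u ∨ X i₁ u} u∉))))
                (proj₂ (∨-false {X i₂ v} (proj₂ (∨-false {X (top base) v ∨ X i₁ v} v∉)))))
        ... | false | false | _ = refl
        ... | true  | false | ()
        ... | false | true  | ()
        Z-spine : ∃ λ v → Z v ≡ true × top v ≤ ℓ
        Z-spine with v , v∈ ← count-witness {p = λ v → Z v ∧ onSpine v}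
            (subst (1 ≤_) (trans same (≡-sym spine-Z)) (≤-trans (≤-reflexive (cong b2n (≡-sym ρx₀))) (m≤m+n _ _))) =
          v , proj₁ (∧-true v∈) , onSpine⇒≤ {v} (proj₂ (∧-true v∈))

  from-arc : ∀ {m} → m ≤ n → Arc ρ m → Outcome m
  from-arc {m} m≤n (x₀ , zero  , ρx₀ , none , end , dense) =
    At.exact x₀ ρx₀ m m≤n (trans (cong ρ (≡-sym (+-identityʳ (x₀ + m)))) end)
  from-arc {m} m≤n (x₀ , suc L , ρx₀ , none , end , dense) = At.approximation x₀ ρx₀ m L m≤n none end dense

  opaque
    outcome : ∀ {m} → m ≤ n → Outcome m
    outcome {m} m≤n with arc record { periodic = ρ-periodic ; total = ρ-total } m≤n
    ... | inj₁ a = from-arc m≤n a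
    ... | inj₂ a = complement m≤n (from-arc (m∸n≤m n m) a)

-- The logarithmic bound and the final labelling

label : ∀ {n} → VSet n → VSet n → Fin n → Fin 3
label Z B v = if Z v then suc (suc zero) else if B v then zero else suc zero

^-distribʳ-* : ∀ a b k → (a * b) ^ k ≡ a ^ k * b ^ k
^-distribʳ-* a b zero    = refl
^-distribʳ-* a b (suc k) = trans (cong (a * b *_) (^-distribʳ-* a b k)) (interchange a b (a ^ k) (b ^ k))
  where
  interchange : ∀ a b c d → a * b * (c * d) ≡ a * c * (b * d)
  interchange = solve-∀

-- This is `e ≤ t Δ log₂ (16 n / c)`, exponentiated and with the power of `c` moved to the left. It
-- reduces to the base `2 ^ (3 + j) * r ≤ 16 * n`, raised to the power `t * Δ`.
cost-bound : ∀ {e s j t Δ c r n} → e ≤ s * Δ → s ≤ (3 + j) * t → c ≤ r → 2 ^ j * r ≤ n →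
             2 ^ e * c ^ (t * Δ) ≤ (16 * n) ^ (t * Δ)
cost-bound {e} {s} {j} {t} {Δ} {c} {r} {n} e≤ s≤ c≤r 2^j≤ = begin
  2 ^ e * c ^ (t * Δ)                        ≤⟨ *-mono-≤ (^-monoʳ-≤ 2 (≤-trans e≤ (*-monoˡ-≤ Δ s≤))) (^-monoˡ-≤ (t * Δ) c≤r) ⟩
  2 ^ ((3 + j) * t * Δ) * r ^ (t * Δ)        ≡⟨ cong (λ x → 2 ^ x * r ^ (t * Δ)) (*-assoc (3 + j) t Δ) ⟩
  2 ^ ((3 + j) * (t * Δ)) * r ^ (t * Δ)      ≡⟨ cong (_* r ^ (t * Δ)) (^-*-assoc 2 (3 + j) (t * Δ)) ⟨
  (2 ^ (3 + j)) ^ (t * Δ) * r ^ (t * Δ)      ≡⟨ ^-distribʳ-* (2 ^ (3 + j)) r (t * Δ) ⟨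
  (2 ^ (3 + j) * r) ^ (t * Δ)                ≤⟨ ^-monoˡ-≤ (t * Δ) base ⟩
  (16 * n) ^ (t * Δ)                         ∎
  where
  open ≤-Reasoning
  base : 2 ^ (3 + j) * r ≤ 16 * n
  base = begin
    2 ^ (3 + j) * r      ≡⟨ cong (_* r) (^-distribˡ-+-* 2 3 j) ⟩
    8 * 2 ^ j * r        ≡⟨ *-assoc 8 (2 ^ j) r ⟩
    8 * (2 ^ j * r)      ≤⟨ *-mono-≤ (m≤m+n 8 8) 2^j≤ ⟩
    16 * n               ∎

theorem4p2 : ∀ (n : ℕ) (G : Graph n) (t : ℕ)
    (D : TreeDec G ⊤) → WidthAtMost-1+ D t →
    (P : TPath (T D)) → Nonredundant D P →
    (m : ℕ) → 1 ≤ m → m ≤ n →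
    ∃ λ (f : Fin n → Fin 3) →
      let B = part f zero
          W = part f (suc zero)
          Z = part f (suc (suc zero))
          e = crossEdges G f
          Δ = maxDegree G
      in (∣ B ∣ ≡ m × ∣ Z ∣ ≡ 0 × e ≤ 2 * t * Δ)
         ⊎ (∣ B ∣ ≤ m × m ≤ ∣ B ∣ + ∣ Z ∣ × 0 < ∣ Z ∣ × 2 * ∣ Z ∣ ≤ n
            × 2 ^ e * coverSize D P ^ (t * Δ) ≤ (16 * n) ^ (t * Δ)
            × Σ (TreeDec G Z) (λ D′ → WidthAtMost-1+ D′ t
                × Σ (TPath (T D′)) (λ P′ → Nonredundant D′ P′
                    × 2 * coverSize D P * ∣ Z ∣ ≤ coverSize D′ P′ * n)))
theorem4p2 n G t D D-width P P-nonred m 1≤m m≤n = f , conclude sizes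
  where
  open Spanning D P
  open SpineRooted spineRooted
  open RootedProperties rooted

  width : ∀ i → count (X i) ≤ t
  width i with j , X⊆ ← X-bag i = begin
    count (X i)                ≤⟨ count-mono (λ v v∈ → []=⇒lookup (X⊆ v v∈)) ⟩
    count (lookup (bag D j))   ≡⟨ ∣∣-lookup (bag D j) ⟨
    ∣ bag D j ∣                ≤⟨ D-width j ⟩
    t                          ∎
    where open ≤-Reasoning

  r : ℕ
  r = count (λ v → top v ≤ᵇ ℓ)

  on-path : ∀ h {v} → v ∈ bag D (node P h) → (top v ≤ᵇ ℓ) ≡ true
  on-path h v∈ = Equivalence.to T-≡ (≤⇒≤ᵇ (≤-trans (≼⇒≤ (top≼ (onP h v∈))) (≤-pred (toℕ<n h))))

  union : Subset n
  union = ⋃ (map (λ h → bag D (node P h)) (allFin (suc ℓ)))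

  cover≤r : coverSize D P ≤ r
  cover≤r = ≤-trans (≤-reflexive (∣∣-lookup union)) (count-mono λ v v∈ →
    let h , v∈h = ∈-⋃⁻ (λ h → bag D (node P h)) (lookup⇒[]= v union v∈) in on-path h v∈h)

  nonempty-end : Nonredundant D P → ∃ λ h → ¬ bag D (node P h) ≡ ⊥
  nonempty-end (inj₁ (≢⊥ , _)) = _ , ≢⊥
  nonempty-end (inj₂ (≢⊥ , _)) = _ , ≢⊥

  nonempty-witness : ∀ {s : Subset n} → ¬ s ≡ ⊥ → ∃ (_∈ s)
  nonempty-witness {s} ≢⊥ with nonempty? s
  ... | yes ne = ne
  ... | no ¬ne = contradiction (Empty-unique ¬ne) ≢⊥

  -- The nonempty bag at the nonredundant end of `P` provides a spine vertex.
  1≤r : 1 ≤ r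
  1≤r with h , ≢⊥ ← nonempty-end P-nonred with v , v∈ ← nonempty-witness ≢⊥ = count-∈ v (on-path h v∈)

  0<n : 0 < n
  0<n = ≤-trans 1≤m m≤n

  open Partition rooted ℓ spine t width {{>-nonZero 0<n}} 1≤r 0<n using (Outcome; Approximation; outcome)
  open Outcome (outcome m≤n)

  f : Fin n → Fin 3
  f = label Z B

  -- `Z` and `B` are read back from the labelling: `tabulate Z′` is the third part of `f` by
  -- definition, so the restricted decomposition has the required type.
  Z′ B′ : VSet n
  Z′ v = ⌊ f v Fin.≟ suc (suc zero) ⌋
  B′ v = ⌊ f v Fin.≟ zero ⌋

  Z′≗Z : ∀ v → Z′ v ≡ Z v
  Z′≗Z v with Z v | B v
  ... | true  | _     = refl
  ... | false | true  = refl
  ... | false | false = refl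

  B′≗B : ∀ v → B′ v ≡ B v
  B′≗B v with Z v | B v | disjoint v
  ... | true  | _     | d = ≡-sym (d refl)
  ... | false | true  | _ = refl
  ... | false | false | _ = refl

  ∣Z∣ : ∣ part f (suc (suc zero)) ∣ ≡ count Z
  ∣Z∣ = trans (∣tabulate∣ Z′) (count-cong Z′≗Z)

  ∣B∣ : ∣ part f zero ∣ ≡ count B
  ∣B∣ = trans (∣tabulate∣ B′) (count-cong B′≗B)

  Δ : ℕ
  Δ = maxDegree G

  cross≤ : crossEdges G f ≤ count Q * Δ
  cross≤ = crossEdges-≤ G f Q λ u v uv u∉ v∉ →
    cong₂ (λ z b → if z then suc (suc zero) else if b then zero else suc zero)
      (sep-Z u v uv u∉ v∉) (sep-B u v uv u∉ v∉)

  open Spine.Restrict rooted ℓ spine Z′ using (D′; restricted-path)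

  conclude : (count B ≡ m × (∀ v → Z v ≡ false) × count Q ≤ 2 * t) ⊎ _ → _
  conclude (inj₁ (B≡m , empty , Q≤)) = inj₁
    (trans ∣B∣ B≡m , trans ∣Z∣ (count-none Z empty) , ≤-trans cross≤ (*-monoˡ-≤ Δ Q≤))
  conclude (inj₂ a) = inj₂
    ( subst (_≤ m) (≡-sym ∣B∣) lower
    , subst₂ (λ b z → m ≤ b + z) (≡-sym ∣B∣) (≡-sym ∣Z∣) upper
    , subst (0 <_) (≡-sym ∣Z∣) (count-∈ z₀ z₀∈Z)
    , subst (λ z → 2 * z ≤ n) (≡-sym ∣Z∣) Z-small
    , cost-bound {j = steps} {t = t} cross≤ Q-bags cover≤r steps-≤
    , D′ , D′-width , proj₁ path , proj₁ (proj₂ path) , dense )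
    where
    open Approximation a
    open ≤-Reasoning
    z₀ : Fin n
    z₀ = proj₁ Z-spine
    z₀∈Z : Z z₀ ≡ true
    z₀∈Z = proj₁ (proj₂ Z-spine)
    path : Σ (TPath (T D′)) λ P′ → Nonredundant D′ P′ × count (λ v → Z′ v ∧ (top v ≤ᵇ ℓ)) ≤ coverSize D′ P′
    path = restricted-path (z₀ , trans (Z′≗Z z₀) z₀∈Z , proj₂ (proj₂ Z-spine))
    D′-width : WidthAtMost-1+ D′ t
    D′-width i = begin
      ∣ bag D′ i ∣                          ≡⟨ ∣tabulate∣ (λ v → X (toℕ i) v ∧ Z′ v) ⟩
      count (λ v → X (toℕ i) v ∧ Z′ v)      ≤⟨ count-mono {q = X (toℕ i)} (λ v v∈ → proj₁ (∧-true v∈)) ⟩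
      count (X (toℕ i))                     ≤⟨ width (toℕ i) ⟩
      t                                     ∎
    dense : 2 * coverSize D P * ∣ part f (suc (suc zero)) ∣ ≤ coverSize D′ (proj₁ path) * n
    dense = begin
      2 * coverSize D P * ∣ part f (suc (suc zero)) ∣   ≡⟨ cong (2 * coverSize D P *_) ∣Z∣ ⟩
      2 * coverSize D P * count Z                       ≤⟨ *-monoˡ-≤ (count Z) (*-monoʳ-≤ 2 cover≤r) ⟩
      2 * r * count Z                                   ≤⟨ Z-dense ⟩
      n * count (λ v → Z v ∧ (top v ≤ᵇ ℓ))
        ≡⟨ cong (n *_) (count-cong λ v → cong (_∧ (top v ≤ᵇ ℓ)) (Z′≗Z v)) ⟨
      n * count (λ v → Z′ v ∧ (top v ≤ᵇ ℓ))             ≤⟨ *-monoʳ-≤ n (proj₂ (proj₂ path)) ⟩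
      n * coverSize D′ (proj₁ path)                     ≡⟨ *-comm n _ ⟩
      coverSize D′ (proj₁ path) * n                     ∎
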